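{- Let $c$ be a constant with $0<c<\frac12$. There exists a real constant $\delta=\delta(c)>0$ such that for every $n\in\mathbb{N}$ and every integer $k$ with $cn<k<(1-c)n$, $$\max\{\beta_{[\pm1]}(n,k),\beta_{[\pm1]}(n,k-1),\beta_{[\pm1]}(n,k-2),\beta_{[\pm1]}(n,k-3)\}\ge \delta n.$$
   Context: For a positive integer $n$, $[n]=\{1,\dots,n\}$ and $\binom{[n]}{k}$ is the family of all $k$-element subsets of $[n]$. For a set $D$ of integers and families $\mathcal{F},\mathcal{F}'$ of subsets of $[n]$, $\mathcal{F}'$ is called $D$-secting for $\mathcal{F}$ if for every $A\in\mathcal{F}$ there exists $A'\in\mathcal{F}'$ with $|A\cap A'|-|A\cap([n]\setminus A')|\in D$. $\beta_D(\mathcal{F})$ is the minimum cardinality of a $D$-secting family for $\mathcal{F}$; $\beta_{[\pm 1]}$ denotes $\beta_D$ with $D=\{ -1,0,1\}$. $\beta_{[\pm1]}(n,k)$ is the maximum of $\beta_{[\pm1]}(\mathcal{F})$ over all families $\mathcal{F}\subseteq\binom{[n]}{k}$. -}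

module Defs where

open import Data.Nat as ℕ using (ℕ)
open import Data.Integer as ℤ using (ℤ; +_)
open import Data.Rational as ℚ using (ℚ; _/_)
open import Data.Fin.Subset using (Subset; _∩_; ∁; ∣_∣)
open import Data.List using (List; length)
open import Data.List.Relation.Unary.All using (All)
open import Data.List.Relation.Unary.Any using (Any)
open import Data.Product using (Σ; _×_)
open import Relation.Binary.PropositionalEquality using (_≡_)

-- a family of subsets of [n] (a finite list; repetitions are harmless for β)
Family : ℕ → Set
Family n = List (Subset n)

-- every member of F has exactly ℓ elements (ℓ an integer; for ℓ < 0 only the empty family)
Uniform : ∀ {n} → ℤ → Family n → Set
Uniform ℓ F = All (λ A → + ∣ A ∣ ≡ ℓ) F

sectVal : ∀ {n} → Subset n → Subset n → ℤ
sectVal A A' = + ∣ A ∩ A' ∣ ℤ.- + ∣ A ∩ ∁ A' ∣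

D±1 : ℤ → Set
D±1 x = ℤ.∣ x ∣ ℕ.≤ 1

Secting : ∀ {n} → (ℤ → Set) → Family n → Family n → Set
Secting D F F' = All (λ A → Any (λ A' → D (sectVal A A')) F') F

toℚ : ℕ → ℚ
toℚ m = + m / 1

-- β_{[±1]}(F) ≥ x  (minimum size of a [±1]-secting family is at least x)
βAtLeast : ∀ {n} → Family n → ℚ → Set
βAtLeast {n} F x = (F' : Family n) → Secting D±1 F F' → x ℚ.≤ toℚ (length F')

-- β_{[±1]}(n,ℓ) ≥ x  (max over ℓ-uniform families F ⊆ binom([n],ℓ))
βnkAtLeast : ℕ → ℤ → ℚ → Set
βnkAtLeast n ℓ x = Σ (Family n) (λ F → Uniform ℓ F × βAtLeast F x)

{-# OPTIONS --safe #-}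
module Submission where

-- Let k = 2h be even and let A'₁, …, A'ₘ have ±1 vectors v₁, …, vₘ.  If they bisect every k-set,
-- then f(x) = ∏ᵢ ⟨x, vᵢ⟩ vanishes on all 0/1 vectors of weight k.  For a prime p > m and k + m ≤ n,
-- a polynomial of degree m that vanishes modulo p on weight K + p also vanishes modulo p on weight K:
-- above a set y of size K choose p + m coordinates; summing over the p-subsets of them kills every
-- monomial of degree t = 1, …, m, because p divides C(p + m − t, p − t), while p does not divide
-- C(p + m, p).  Hence f vanishes modulo p on weight w = k mod p.  If ⌊k/p⌋ is odd, then so is w, each
-- ⟨y, vᵢ⟩ with |y| = w is odd and smaller than p in absolute value, and f(y) ≢ 0: a contradiction.
--
-- By Lucas' theorem, a prime p > √k has odd ⌊k/p⌋ as soon as it divides C(2h, h), and Chebyshev's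
-- estimates show that C(2h, h) has a prime divisor of order h.

open import Defs

-- The argument needs `m < p` and `k + m ≤ n`, and each failure already makes `m` large. This is the
-- source of the dichotomy in `hard-family`: `k ≤ 4096 m`, or `n ≤ k + m`. With `cn < k` and
-- `n - k > cn`, either alternative gives `m ≥ (c/4096) n`. The obstacle is the parity of `⌊k/p⌋`: a
-- prime of the right order is not enough by itself. Divisibility of `C(2h, h)` by `p` encodes that
-- parity, so a lower bound for this one number replaces any knowledge of where primes lie. It
-- yields `p > 4^g` with `2·4^g ≤ h < 8·4^g`, hence `p` within a constant factor of `k`. The
-- estimates start at `g = 5`, that is at `h = 2·4^5 = 2048`. For smaller `h` one has `k ≤ 4096`,
-- and a family with a single `k`-set, which needs at least one secting set, satisfies the
-- dichotomy. An odd `k` is replaced by the even number `k - 1`.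

module Combinatorial where

  open import Data.Nat.Base using (ℕ; zero; suc; _+_; _*_; _∸_; _⊓_; _^_; _!; _≤_; _<_; z≤n; s≤s; >-nonZero)
  open import Data.Nat.Properties
  open import Data.Nat.Combinatorics using (_C_; k>n⇒nCk≡0; nCk+nC[k+1]≡[n+1]C[k+1]; nCk≡nC[n∸k]; nC1≡n; nCn≡1)
  open import Data.Nat.Divisibility
  open import Data.Nat.DivMod using (_/_; _%_; m≡m%n+[m/n]*n; m%n<n)
  open import Data.Nat.Induction using (<-rec)
  open import Data.Nat.ListAction using (product) renaming (sum to listSum)
  open import Data.Nat.ListAction.Properties using (sum-++)
  open import Data.Nat.Primality using (Prime; prime?; euclidsLemma; ¬prime[0]; ¬prime[1]; prime⇒nonZero; prime⇒irreducible)
  open import Data.Nat.Primality.Factorisation using (factorise)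
  open import Data.Nat.Tactic.RingSolver using (solve-∀)
  open import Algebra.Properties.Semiring.Sum +-*-semiring using (sum; sum-cong-≗; ∑-distrib-+; *-distribˡ-sum; *-distribʳ-sum; sum-replicate-zero)
  import Data.Integer as ℤ
  import Data.Integer.Properties as ℤ
  open import Data.Bool.Base using (if_then_else_)
  open import Data.Empty using (⊥)
  open import Data.Fin.Base as Fin using (Fin; zero; suc; toℕ)
  open import Data.Fin.Subset using (Subset; Side; inside; outside; ∣_∣; _∩_; ∁; _⊆_; ⊤) renaming (⊥ to ∅)
  open import Data.Fin.Subset.Properties using (_⊆?_; ⊆-trans; p⊆q⇒∣p∣≤∣q∣; drop-∷-⊆; out⊆; in⊆in; ∣⊤∣≡n; ∣⊥∣≡0; ⊆-max)
  open import Data.List.Base using (List; []; _∷_; map; _++_; length)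
  open import Data.List.Properties using (map-++; map-∘; map-cong; length-map)
  open import Data.List.Relation.Unary.All as All using (All; []; _∷_)
  import Data.List.Relation.Unary.All.Properties as All
  open import Data.List.Relation.Unary.Any as Any using (Any; here; there)
  import Data.List.Relation.Unary.Any.Properties as Any
  open import Data.Product using (Σ; ∃; ∃₂; _×_; _,_)
  open import Data.Sum using (_⊎_; inj₁; inj₂; [_,_]′)
  open import Data.Vec.Base using ([]; _∷_; lookup; _[_]≔_; here)
  open import Function using (_∘_)
  open import Relation.Nullary using (¬_; yes; no; contradiction; does)
  open import Relation.Binary.PropositionalEquality using (_≡_; _≢_; _≗_; refl; sym; trans; cong; cong₂; subst; module ≡-Reasoning)

  -- Binomial coefficients modulo a prime, up to Lucas' theorem

  pascal : ∀ n k → suc n C suc k ≡ n C k + n C suc k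
  pascal n k = sym (nCk+nC[k+1]≡[n+1]C[k+1] n k)

  absorption : ∀ n k → suc k * (suc n C suc k) ≡ suc n * (n C k)
  absorption n zero = trans (+-identityʳ _) (trans (nC1≡n (suc n)) (sym (*-identityʳ (suc n))))
  absorption zero (suc k) = *-zeroʳ (2 + k)
  absorption (suc n) (suc k) = begin
    (2 + k) * (suc (suc n) C suc (suc k))
      ≡⟨ cong ((2 + k) *_) (pascal (suc n) (suc k)) ⟩
    (2 + k) * (suc n C suc k + suc n C suc (suc k))
      ≡⟨ regroup k (suc n C suc k) (suc n C suc (suc k)) ⟩
    suc k * (suc n C suc k) + (suc n C suc k) + (2 + k) * (suc n C suc (suc k))
      ≡⟨ cong₂ (λ a b → a + (suc n C suc k) + b) (absorption n k) (absorption n (suc k)) ⟩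
    suc n * (n C k) + (suc n C suc k) + suc n * (n C suc k)
      ≡⟨ collect n (n C k) (suc n C suc k) (n C suc k) ⟩
    suc n * (n C k + n C suc k) + (suc n C suc k)
      ≡⟨ cong (λ a → suc n * a + (suc n C suc k)) (pascal n k) ⟨
    suc n * (suc n C suc k) + (suc n C suc k)
      ≡⟨ +-comm (suc n * (suc n C suc k)) (suc n C suc k) ⟩
    (2 + n) * (suc n C suc k) ∎
    where
    open ≡-Reasoning
    regroup : ∀ k x y → (2 + k) * (x + y) ≡ (1 + k) * x + x + (2 + k) * y
    regroup = solve-∀
    collect : ∀ n a x b → (1 + n) * a + x + (1 + n) * b ≡ (1 + n) * (a + b) + x
    collect = solve-∀

  p∤n! : ∀ {p n} → Prime p → n < p → p ∤ n !
  p∤n! {p} {zero} pp n<p p∣1 = contradiction (∣1⇒≡1 p∣1) λ { refl → ¬prime[1] pp }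
  p∤n! {p} {suc n} pp n<p p∣ with euclidsLemma (suc n) (n !) pp p∣
  ... | inj₁ p∣1+n = >⇒∤ n<p p∣1+n
  ... | inj₂ p∣n!  = p∤n! pp (<-trans (n<1+n n) n<p) p∣n!

  p∣pCk : ∀ {p k} → Prime (suc p) → k < p → suc p ∣ suc p C suc k
  p∣pCk {p} {k} pp k<p with euclidsLemma (suc k) (suc p C suc k) pp
                           (subst (suc p ∣_) (sym (absorption p k)) (m∣m*n (p C k)))
  ... | inj₁ p∣k = contradiction p∣k (>⇒∤ (s≤s k<p))
  ... | inj₂ p∣C = p∣C

  -- By `absorption`, a factor `p` of `C(n+1, k+1)` would divide `n + 1`, which is too small, or
  -- `C(n, k)`; the descent ends at 1.
  p∤nCk : ∀ {p n k} → Prime p → n < p → k ≤ n → p ∤ n C k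
  p∤nCk {p} {n} {zero} pp n<p k≤n p∣1 = p∤n! {n = 0} pp (≤-<-trans z≤n n<p) p∣1
  p∤nCk {p} {suc n} {suc k} pp n<p (s≤s k≤n) p∣
    with euclidsLemma (suc n) (n C k) pp (subst (p ∣_) (absorption n k) (∣n⇒∣m*n (suc k) p∣))
  ... | inj₁ p∣1+n = >⇒∤ n<p p∣1+n
  ... | inj₂ p∣C = p∤nCk pp (<-trans (n<1+n n) n<p) k≤n p∣C

  -- The congruences modulo p below have the larger side on the left, so the
  -- difference is recorded as a natural multiple of p.
  [p+n]Ck : ∀ {p} → Prime p → ∀ n k → k < p → ∃ λ q → (p + n) C k ≡ n C k + p * q
  [p+n]Ck {p} pp n zero k<p = 0 , cong suc (sym (*-zeroʳ p))
  [p+n]Ck {suc p} pp zero (suc k) (s≤s k<p) with p∣pCk pp k<p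
  ... | divides q eq = q , (begin
    (suc p + 0) C suc k     ≡⟨ cong (_C suc k) (+-identityʳ (suc p)) ⟩
    suc p C suc k           ≡⟨ eq ⟩
    q * suc p               ≡⟨ *-comm q (suc p) ⟩
    0 C suc k + suc p * q   ∎)
    where open ≡-Reasoning
  [p+n]Ck {p} pp (suc n) (suc k) k<p
    with [p+n]Ck pp n k (<-trans (n<1+n k) k<p) | [p+n]Ck pp n (suc k) k<p
  ... | q , e | q′ , e′ = q + q′ , (begin
    (p + suc n) C suc k                 ≡⟨ cong (_C suc k) (+-suc p n) ⟩
    suc (p + n) C suc k                 ≡⟨ pascal (p + n) k ⟩
    (p + n) C k + (p + n) C suc k       ≡⟨ cong₂ _+_ e e′ ⟩
    (n C k + p * q) + (n C suc k + p * q′) ≡⟨ regroup (n C k) (n C suc k) p q q′ ⟩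
    (n C k + n C suc k) + p * (q + q′)  ≡⟨ cong (_+ p * (q + q′)) (pascal n k) ⟨
    suc n C suc k + p * (q + q′)        ∎)
    where
    open ≡-Reasoning
    regroup : ∀ a b p q q′ → (a + p * q) + (b + p * q′) ≡ (a + b) + p * (q + q′)
    regroup = solve-∀

  -- Coefficient of `x^(p+k)` in the congruence `(1+x)^(p+n) ≡ (1+x^p)(1+x)^n` modulo `p`; `[p+n]Ck`
  -- handles the coefficients below `x^p`.
  [p+n]C[p+k] : ∀ {p} → Prime p → ∀ n k → ∃ λ q → (p + n) C (p + k) ≡ n C (p + k) + n C k + p * q
  [p+n]C[p+k] {zero} pp = contradiction pp ¬prime[0]
  [p+n]C[p+k] {suc p} pp zero zero = 0 , (begin
    (suc p + 0) C (suc p + 0) ≡⟨ nCn≡1 (suc p + 0) ⟩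
    1                         ≡⟨ cong suc (*-zeroʳ (suc p)) ⟨
    0 C (suc p + 0) + 0 C 0 + suc p * 0 ∎)
    where open ≡-Reasoning
  [p+n]C[p+k] {suc p} pp zero (suc k) = 0 , (begin
    (suc p + 0) C (suc p + suc k)  ≡⟨ k>n⇒nCk≡0 (+-monoʳ-< (suc p) (s≤s z≤n)) ⟩
    0                              ≡⟨ *-zeroʳ (suc p) ⟨
    0 C (suc p + suc k) + 0 C suc k + suc p * 0 ∎)
    where open ≡-Reasoning
  [p+n]C[p+k] {suc p} pp (suc n) zero
    with [p+n]Ck pp n p (n<1+n p) | [p+n]C[p+k] pp n zero
  ... | q , e | q′ , e′ = q + q′ , (begin
    (suc p + suc n) C (suc p + 0)  ≡⟨ cong₂ _C_ (+-suc (suc p) n) (cong suc (+-identityʳ p)) ⟩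
    suc (suc p + n) C suc p        ≡⟨ pascal (suc p + n) p ⟩
    (suc p + n) C p + (suc p + n) C suc p
      ≡⟨ cong₂ _+_ e (trans (cong ((suc p + n) C_) (cong suc (sym (+-identityʳ p)))) e′) ⟩
    (n C p + suc p * q) + (n C (suc p + 0) + 1 + suc p * q′)
      ≡⟨ cong (λ x → (n C p + suc p * q) + (n C suc x + 1 + suc p * q′)) (+-identityʳ p) ⟩
    (n C p + suc p * q) + (n C suc p + 1 + suc p * q′)
      ≡⟨ regroup (n C p) (n C suc p) p q q′ ⟩
    (n C p + n C suc p) + 1 + suc p * (q + q′)
      ≡⟨ cong (λ x → x + 1 + suc p * (q + q′)) (pascal n p) ⟨
    suc n C suc p + 1 + suc p * (q + q′)
      ≡⟨ cong (λ x → suc n C suc x + 1 + suc p * (q + q′)) (+-identityʳ p) ⟨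
    suc n C (suc p + 0) + suc n C 0 + suc p * (q + q′) ∎)
    where
    open ≡-Reasoning
    regroup : ∀ a b p q q′ → (a + (1 + p) * q) + (b + 1 + (1 + p) * q′) ≡ (a + b) + 1 + (1 + p) * (q + q′)
    regroup = solve-∀
  [p+n]C[p+k] {p@(suc _)} pp (suc n) (suc k)
    with [p+n]C[p+k] pp n k | [p+n]C[p+k] pp n (suc k)
  ... | q , e | q′ , e′ = q + q′ , (begin
    (p + suc n) C (p + suc k)  ≡⟨ cong₂ _C_ (+-suc p n) (+-suc p k) ⟩
    suc (p + n) C suc (p + k)  ≡⟨ pascal (p + n) (p + k) ⟩
    (p + n) C (p + k) + (p + n) C suc (p + k)
      ≡⟨ cong₂ _+_ e (trans (cong ((p + n) C_) (sym (+-suc p k))) e′) ⟩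
    (n C (p + k) + n C k + p * q) + (n C (p + suc k) + n C suc k + p * q′)
      ≡⟨ cong (λ x → (n C (p + k) + n C k + p * q) + (n C x + n C suc k + p * q′)) (+-suc p k) ⟩
    (n C (p + k) + n C k + p * q) + (n C suc (p + k) + n C suc k + p * q′)
      ≡⟨ regroup (n C (p + k)) (n C k) (n C suc (p + k)) (n C suc k) p q q′ ⟩
    (n C (p + k) + n C suc (p + k)) + (n C k + n C suc k) + p * (q + q′)
      ≡⟨ cong₂ (λ x y → x + y + p * (q + q′)) (pascal n (p + k)) (pascal n k) ⟨
    suc n C suc (p + k) + suc n C suc k + p * (q + q′)
      ≡⟨ cong (λ x → suc n C x + suc n C suc k + p * (q + q′)) (+-suc p k) ⟨
    suc n C (p + suc k) + suc n C suc k + p * (q + q′) ∎)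
    where
    open ≡-Reasoning
    regroup : ∀ a b c d p q q′ → (a + b + p * q) + (c + d + p * q′) ≡ (a + c) + (b + d) + p * (q + q′)
    regroup = solve-∀

  -- Removing one `p` from both entries by `[p+n]C[p+k]` is Pascal's rule for the leading parts `a`
  -- and `c`. These are arbitrary numbers and not digits, so one application splits off the last
  -- digit.
  lucas : ∀ {p} → Prime p → ∀ a c {b d} → b < p → d < p →
    ∃ λ q → (a * p + b) C (c * p + d) ≡ (a C c) * (b C d) + p * q
  lucas {p} pp zero zero {b} {d} b<p d<p = 0 , (begin
    b C d                 ≡⟨ +-identityʳ (b C d) ⟨
    b C d + 0             ≡⟨ cong₂ _+_ (+-identityʳ (b C d)) (*-zeroʳ p) ⟨
    1 * (b C d) + p * 0   ∎)
    where open ≡-Reasoning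
  lucas {p} pp zero (suc c) {b} {d} b<p d<p = 0 , (begin
    b C (p + c * p + d)               ≡⟨ k>n⇒nCk≡0 (<-≤-trans b<p (≤-trans (m≤m+n p (c * p)) (m≤m+n _ d))) ⟩
    0                                 ≡⟨ *-zeroʳ p ⟨
    (0 C suc c) * (b C d) + p * 0     ∎)
    where open ≡-Reasoning
  lucas {p} pp (suc a) zero {b} {d} b<p d<p
    with lucas pp a zero b<p d<p | [p+n]Ck pp (a * p + b) d d<p
  ... | q , e | q′ , e′ = q + q′ , (begin
    (p + a * p + b) C d          ≡⟨ cong (_C d) (+-assoc p (a * p) b) ⟩
    (p + (a * p + b)) C d        ≡⟨ e′ ⟩
    (a * p + b) C d + p * q′     ≡⟨ cong (_+ p * q′) e ⟩
    1 * (b C d) + p * q + p * q′ ≡⟨ +-assoc (1 * (b C d)) (p * q) (p * q′) ⟩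
    1 * (b C d) + (p * q + p * q′) ≡⟨ cong (1 * (b C d) +_) (*-distribˡ-+ p q q′) ⟨
    1 * (b C d) + p * (q + q′)   ∎)
    where open ≡-Reasoning
  lucas {p} pp (suc a) (suc c) {b} {d} b<p d<p
    with lucas pp a (suc c) b<p d<p | lucas pp a c b<p d<p | [p+n]C[p+k] pp (a * p + b) (c * p + d)
  ... | q , e | q′ , e′ | q″ , e″ = q + q′ + q″ , (begin
    (p + a * p + b) C (p + c * p + d)      ≡⟨ cong₂ _C_ (+-assoc p (a * p) b) (+-assoc p (c * p) d) ⟩
    (p + (a * p + b)) C (p + (c * p + d))  ≡⟨ e″ ⟩
    (a * p + b) C (p + (c * p + d)) + (a * p + b) C (c * p + d) + p * q″
      ≡⟨ cong (λ x → (a * p + b) C x + (a * p + b) C (c * p + d) + p * q″) (+-assoc p (c * p) d) ⟨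
    (a * p + b) C (suc c * p + d) + (a * p + b) C (c * p + d) + p * q″
      ≡⟨ cong₂ (λ x y → x + y + p * q″) e e′ ⟩
    ((a C suc c) * (b C d) + p * q) + ((a C c) * (b C d) + p * q′) + p * q″
      ≡⟨ regroup (a C suc c) (a C c) (b C d) p q q′ q″ ⟩
    (a C c + a C suc c) * (b C d) + p * (q + q′ + q″)
      ≡⟨ cong (λ x → x * (b C d) + p * (q + q′ + q″)) (pascal a c) ⟨
    (suc a C suc c) * (b C d) + p * (q + q′ + q″) ∎)
    where
    open ≡-Reasoning
    regroup : ∀ x y z p q q′ q″ → (x * z + p * q) + (y * z + p * q′) + p * q″ ≡ (y + x) * z + p * (q + q′ + q″)
    regroup = solve-∀

  -- The last digit `u` of the upper entry is below that of the lower one, so the leading term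
  -- `C(u, v)` is zero. This serves twice: for the primes between `x` and `2x` in `C(2x, x)`, and
  -- for the monomials killed in the descent.
  p∣[p+u]Cv : ∀ {p u v} → Prime p → u < v → v < p → p ∣ (p + u) C v
  p∣[p+u]Cv {p} {u} {v} pp u<v v<p with [p+n]Ck pp u v v<p
  ... | q , e = divides q (begin
    (p + u) C v   ≡⟨ e ⟩
    u C v + p * q ≡⟨ cong (_+ p * q) (k>n⇒nCk≡0 u<v) ⟩
    p * q         ≡⟨ *-comm p q ⟩
    q * p         ∎)
    where open ≡-Reasoning

  p∤[p+r]Cp : ∀ {p r} → Prime p → r < p → p ∤ (p + r) C p
  p∤[p+r]Cp {p} {r} pp r<p p∣ with [p+n]C[p+k] pp r 0
  ... | q , e = contradiction (∣1⇒≡1 (∣m+n∣m⇒∣n p∣pq+1 (m∣m*n q))) λ { refl → ¬prime[1] pp }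
    where
    open ≡-Reasoning
    p∣pq+1 : p ∣ p * q + 1
    p∣pq+1 = subst (p ∣_) (begin
      (p + r) C p                  ≡⟨ cong ((p + r) C_) (+-identityʳ p) ⟨
      (p + r) C (p + 0)            ≡⟨ e ⟩
      r C (p + 0) + 1 + p * q      ≡⟨ cong (λ x → x + 1 + p * q) (k>n⇒nCk≡0 (subst (r <_) (sym (+-identityʳ p)) r<p)) ⟩
      1 + p * q                    ≡⟨ +-comm 1 (p * q) ⟩
      p * q + 1 ∎) p∣

  -- Size of the central binomial coefficient

  centralBinomial : ℕ → ℕ
  centralBinomial h = (h + h) C h

  centralBinomial-suc : ∀ h → suc h * centralBinomial (suc h) ≡ 2 * suc (h + h) * centralBinomial h
  centralBinomial-suc h = begin
    suc h * (suc (h + suc h) C suc h)                ≡⟨ cong (suc h *_) (pascal (h + suc h) h) ⟩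
    suc h * ((h + suc h) C h + (h + suc h) C suc h)  ≡⟨ cong (λ x → suc h * (x + (h + suc h) C suc h)) symmetric ⟩
    suc h * ((h + suc h) C suc h + (h + suc h) C suc h) ≡⟨ double (suc h) ((h + suc h) C suc h) ⟩
    2 * (suc h * ((h + suc h) C suc h))              ≡⟨ cong (λ x → 2 * (suc h * (x C suc h))) (+-suc h h) ⟩
    2 * (suc h * (suc (h + h) C suc h))              ≡⟨ cong (2 *_) (absorption (h + h) h) ⟩
    2 * (suc (h + h) * ((h + h) C h))                ≡⟨ *-assoc 2 (suc (h + h)) ((h + h) C h) ⟨
    2 * suc (h + h) * ((h + h) C h)                  ∎
    where
    open ≡-Reasoning
    double : ∀ a x → a * (x + x) ≡ 2 * (a * x)
    double = solve-∀
    symmetric : (h + suc h) C h ≡ (h + suc h) C suc h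
    symmetric = trans (nCk≡nC[n∸k] (m≤m+n h (suc h))) (cong ((h + suc h) C_) (m+n∸m≡n h (suc h)))

  centralBinomial≤4^ : ∀ h → centralBinomial h ≤ 4 ^ h
  centralBinomial≤4^ zero = s≤s z≤n
  centralBinomial≤4^ (suc h) = *-cancelˡ-≤ (suc h) (begin
    suc h * centralBinomial (suc h)          ≡⟨ centralBinomial-suc h ⟩
    2 * suc (h + h) * centralBinomial h      ≤⟨ *-mono-≤ (*-monoʳ-≤ 2 (s≤s (+-monoʳ-≤ h (n≤1+n h)))) (centralBinomial≤4^ h) ⟩
    2 * (suc h + suc h) * 4 ^ h              ≡⟨ regroup h (4 ^ h) ⟩
    suc h * (4 * 4 ^ h)                      ∎)
    where
    open ≤-Reasoning
    regroup : ∀ h x → 2 * ((1 + h) + (1 + h)) * x ≡ (1 + h) * (4 * x)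
    regroup = solve-∀

  -- Passing from `h` to `h + 1` multiplies `2h·C(2h, h)` by `2(2h+1)/h`, which exceeds 4.
  4^≤2h*centralBinomial : ∀ h → 4 ^ suc h ≤ (suc h + suc h) * centralBinomial (suc h)
  4^≤2h*centralBinomial zero = ≤-refl
  4^≤2h*centralBinomial (suc h) = begin
    4 * 4 ^ suc h                                ≤⟨ *-monoʳ-≤ 4 (4^≤2h*centralBinomial h) ⟩
    4 * ((suc h + suc h) * centralBinomial (suc h)) ≤⟨ *-monoʳ-≤ 4 (*-monoˡ-≤ (centralBinomial (suc h)) (n≤1+n (suc h + suc h))) ⟩
    4 * (suc (suc h + suc h) * centralBinomial (suc h)) ≡⟨ regroup (suc (suc h + suc h)) (centralBinomial (suc h)) ⟩
    2 * (2 * suc (suc h + suc h) * centralBinomial (suc h)) ≡⟨ cong (2 *_) (centralBinomial-suc (suc h)) ⟨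
    2 * (suc (suc h) * centralBinomial (suc (suc h)))   ≡⟨ double (suc (suc h)) (centralBinomial (suc (suc h))) ⟩
    (suc (suc h) + suc (suc h)) * centralBinomial (suc (suc h)) ∎
    where
    open ≤-Reasoning
    regroup : ∀ a x → 4 * (a * x) ≡ 2 * (2 * a * x)
    regroup = solve-∀
    double : ∀ a x → 2 * (a * x) ≡ (a + a) * x
    double = solve-∀

  -- Prime powers dividing a binomial coefficient

  nCk>0 : ∀ {n k} → k ≤ n → 0 < n C k
  nCk>0 {n} {zero} k≤n = s≤s z≤n
  nCk>0 {suc n} {suc k} (s≤s k≤n) =
    subst (0 <_) (sym (pascal n k)) (≤-trans (nCk>0 k≤n) (m≤m+n (n C k) (n C suc k)))

  [k+1]*nC[k+1] : ∀ k d → suc k * ((k + d) C suc k) ≡ d * ((k + d) C k)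
  [k+1]*nC[k+1] k d = +-cancelˡ-≡ (suc k * ((k + d) C k)) _ _ (begin
    suc k * ((k + d) C k) + suc k * ((k + d) C suc k) ≡⟨ *-distribˡ-+ (suc k) ((k + d) C k) _ ⟨
    suc k * ((k + d) C k + (k + d) C suc k)           ≡⟨ cong (suc k *_) (pascal (k + d) k) ⟨
    suc k * (suc (k + d) C suc k)                     ≡⟨ absorption (k + d) k ⟩
    (suc k + d) * ((k + d) C k)                       ≡⟨ *-distribʳ-+ ((k + d) C k) (suc k) d ⟩
    suc k * ((k + d) C k) + d * ((k + d) C k)         ∎)
    where open ≡-Reasoning

  -- With L(n,k) = (n+1)·C(n,k), the Leibniz triangle identity
  -- 1/L(n+1,k+1) = 1/L(n,k) − 1/L(n+1,k) expresses M/L(n+1,k+1) as a difference of integers.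
  leibniz-∣ : ∀ {M} n k → k ≤ n → (∀ j → suc j ≤ suc n → suc j ∣ M) → suc n * (n C k) ∣ M
  leibniz-∣ {M} n zero k≤n j∣M = subst (_∣ M) (sym (*-identityʳ (suc n))) (j∣M n ≤-refl)
  leibniz-∣ {M} (suc n) (suc k) (s≤s k≤n) j∣M
    with leibniz-∣ n k k≤n (λ j j≤ → j∣M j (m≤n⇒m≤1+n j≤)) | leibniz-∣ (suc n) k (m≤n⇒m≤1+n k≤n) j∣M
  ... | divides a M≡aL | divides b M≡bL =
    ∣m+n∣m⇒∣n (divides a b[n+2]Y+M≡a[n+2]Y) (n∣m*n b)
    where
    open ≡-Reasoning
    d = suc n ∸ k
    X = suc n C k
    Y = suc n C suc k
    k+d≡1+n : k + d ≡ suc n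
    k+d≡1+n = m+[n∸m]≡n (m≤n⇒m≤1+n k≤n)
    [k+1]Y≡dX : suc k * Y ≡ d * X
    [k+1]Y≡dX = subst (λ x → suc k * (x C suc k) ≡ d * (x C k)) k+d≡1+n ([k+1]*nC[k+1] k d)
    M≡a[k+1]Y : M ≡ a * (suc k * Y)
    M≡a[k+1]Y = trans M≡aL (cong (a *_) (sym (absorption n k)))
    ad≡b[n+2] : a * d ≡ b * suc (suc n)
    ad≡b[n+2] = *-cancelʳ-≡ (a * d) (b * suc (suc n)) X {{>-nonZero (nCk>0 (m≤n⇒m≤1+n k≤n))}} (begin
      a * d * X             ≡⟨ *-assoc a d X ⟩
      a * (d * X)           ≡⟨ cong (a *_) [k+1]Y≡dX ⟨
      a * (suc k * Y)       ≡⟨ M≡a[k+1]Y ⟨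
      M                     ≡⟨ M≡bL ⟩
      b * (suc (suc n) * X) ≡⟨ *-assoc b (suc (suc n)) X ⟨
      b * suc (suc n) * X   ∎)
    regroup : ∀ a d y k → a * d * y + a * ((1 + k) * y) ≡ a * ((1 + (k + d)) * y)
    regroup = solve-∀
    b[n+2]Y+M≡a[n+2]Y : b * (suc (suc n) * Y) + M ≡ a * (suc (suc n) * Y)
    b[n+2]Y+M≡a[n+2]Y = begin
      b * (suc (suc n) * Y) + M      ≡⟨ cong₂ _+_ (sym (*-assoc b (suc (suc n)) Y)) M≡a[k+1]Y ⟩
      b * suc (suc n) * Y + a * (suc k * Y) ≡⟨ cong (λ x → x * Y + a * (suc k * Y)) ad≡b[n+2] ⟨
      a * d * Y + a * (suc k * Y)    ≡⟨ regroup a d Y k ⟩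
      a * (suc (k + d) * Y)          ≡⟨ cong (λ x → a * (suc x * Y)) k+d≡1+n ⟩
      a * (suc (suc n) * Y)          ∎

  prime>1 : ∀ {p} → Prime p → 1 < p
  prime>1 {zero} pp = contradiction pp ¬prime[0]
  prime>1 {suc zero} pp = contradiction pp ¬prime[1]
  prime>1 {suc (suc p)} pp = s≤s (s≤s z≤n)

  prime-power-split : ∀ {p} → Prime p → ∀ n → 0 < n → ∃₂ λ a u → n ≡ p ^ a * u × p ∤ u
  prime-power-split {p} pp = <-rec _ step
    where
    step : ∀ n → (∀ {m} → m < n → 0 < m → ∃₂ λ a u → m ≡ p ^ a * u × p ∤ u) →
           0 < n → ∃₂ λ a u → n ≡ p ^ a * u × p ∤ u
    step n rec 0<n with p ∣? n
    ... | no p∤n = 0 , n , sym (+-identityʳ n) , p∤n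
    ... | yes (divides zero n≡0) = contradiction (subst (0 <_) n≡0 0<n) λ ()
    ... | yes (divides q@(suc _) n≡qp) with rec (subst (q <_) (sym n≡qp) (m<m*n q p (prime>1 pp))) (s≤s z≤n)
    ...   | a , u , q≡ , p∤u = suc a , u , (begin
      n                ≡⟨ n≡qp ⟩
      q * p            ≡⟨ *-comm q p ⟩
      p * q            ≡⟨ cong (p *_) q≡ ⟩
      p * (p ^ a * u)  ≡⟨ *-assoc p (p ^ a) u ⟨
      p * p ^ a * u    ∎) , p∤u
      where open ≡-Reasoning

  p^>0 : ∀ {p} → Prime p → ∀ a → 0 < p ^ a
  p^>0 {p} pp a = m^n>0 p {{prime⇒nonZero pp}} a

  p^a∣p^b*u⇒p^a≤p^b : ∀ {p u} → Prime p → p ∤ u → ∀ a b → p ^ a ∣ p ^ b * u → p ^ a ≤ p ^ b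
  p^a∣p^b*u⇒p^a≤p^b pp p∤u zero b _ = p^>0 pp b
  p^a∣p^b*u⇒p^a≤p^b {p} {u} pp p∤u (suc a) zero p^∣ =
    contradiction (subst (p ∣_) (+-identityʳ u) (m*n∣⇒m∣ p (p ^ a) p^∣)) p∤u
  p^a∣p^b*u⇒p^a≤p^b {p} {u} pp p∤u (suc a) (suc b) p^∣ =
    *-monoʳ-≤ p (p^a∣p^b*u⇒p^a≤p^b pp p∤u a b
      (*-cancelˡ-∣ p {{prime⇒nonZero pp}} (subst (p ^ suc a ∣_) (*-assoc p (p ^ b) u) p^∣)))

  ^-monoʳ-∣ : ∀ m {i j} → i ≤ j → m ^ i ∣ m ^ j
  ^-monoʳ-∣ m {i} {j} i≤j = divides (m ^ (j ∸ i)) (trans (cong (m ^_) (sym (m∸n+n≡m i≤j))) (^-distribˡ-+-* m (j ∸ i) i))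

  -- A substitute for `lcm(1, …, n+1)` in which only the `p`-part is exact: the exponent of `p` is a
  -- maximum, while the `p`-free cofactors are simply multiplied into `u`.
  common-multiple : ∀ {p} → Prime p → ∀ n →
    ∃₂ λ b u → p ^ b ≤ suc n × p ∤ u × (∀ j → suc j ≤ suc n → suc j ∣ p ^ b * u)
  common-multiple {p} pp zero = 0 , 1 , ≤-refl , p∤n! {n = 0} pp (<-trans (s≤s z≤n) (prime>1 pp)) ,
    λ { zero _ → 1∣ 1 ; (suc j) (s≤s ()) }
  common-multiple {p} pp (suc n) with common-multiple pp n | prime-power-split pp (suc (suc n)) (s≤s z≤n)
  ... | b , u , p^b≤ , p∤u , all | i , v , n≡ , p∤v with ≤-total i b
  ...   | inj₁ i≤b = b , u * v , m≤n⇒m≤1+n p^b≤ , p∤uv , divs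
    where
    p∤uv : p ∤ u * v
    p∤uv p∣ = [ p∤u , p∤v ]′ (euclidsLemma u v pp p∣)
    divs : ∀ j → suc j ≤ suc (suc n) → suc j ∣ p ^ b * (u * v)
    divs j j≤ with m≤n⇒m<n∨m≡n j≤
    ... | inj₁ (s≤s j<) = subst (suc j ∣_) (*-assoc (p ^ b) u v) (∣m⇒∣m*n v (all j j<))
    ... | inj₂ refl = subst (_∣ p ^ b * (u * v)) (sym n≡)
      (*-pres-∣ (^-monoʳ-∣ p i≤b) (n∣m*n u))
  ...   | inj₂ b≤i = i , u * v , p^i≤ , p∤uv , divs
    where
    p∤uv : p ∤ u * v
    p∤uv p∣ = [ p∤u , p∤v ]′ (euclidsLemma u v pp p∣)
    p^i≤ : p ^ i ≤ suc (suc n)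
    p^i≤ = ∣⇒≤ (divides v (trans n≡ (*-comm (p ^ i) v)))
    divs : ∀ j → suc j ≤ suc (suc n) → suc j ∣ p ^ i * (u * v)
    divs j j≤ with m≤n⇒m<n∨m≡n j≤
    ... | inj₁ (s≤s j<) = ∣-trans (all j j<) (*-pres-∣ (^-monoʳ-∣ p b≤i) (m∣m*n v))
    ... | inj₂ refl = subst (_∣ p ^ i * (u * v)) (sym n≡) (*-monoʳ-∣ (p ^ i) (n∣m*n u))

  -- By absorption and the Leibniz triangle, `C(n+1, k+1)` divides every common multiple of
  -- `1, …, n+1`, in particular one whose `p`-part is at most `n + 1`. No formula for the exponent
  -- of `p` is involved.
  p^a∣nCk⇒p^a≤n : ∀ {p n k} → Prime p → k ≤ n → ∀ a → p ^ a ∣ suc n C suc k → p ^ a ≤ suc n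
  p^a∣nCk⇒p^a≤n {p} {n} {k} pp k≤n a p^a∣C with common-multiple pp n
  ... | b , u , p^b≤ , p∤u , all = ≤-trans (p^a∣p^b*u⇒p^a≤p^b pp p∤u a b (∣-trans p^a∣C C∣)) p^b≤
    where
    C∣ : suc n C suc k ∣ p ^ b * u
    C∣ = m*n∣⇒n∣ (suc k) _ (subst (_∣ p ^ b * u) (sym (absorption n k)) (leibniz-∣ n k k≤n all))

  -- Primorials and Chebyshev's estimate

  primePart : ℕ → ℕ
  primePart n = if does (prime? n) then n else 1

  primePart-prime : ∀ {p} → Prime p → primePart p ≡ p
  primePart-prime {p} pp with prime? p
  ... | yes _  = refl
  ... | no ¬pp = contradiction pp ¬pp

  primePart>0 : ∀ n → 0 < primePart n
  primePart>0 n with prime? n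
  ... | yes pp = <-trans (s≤s z≤n) (prime>1 pp)
  ... | no _   = s≤s z≤n

  primorial : ℕ → ℕ
  primorial zero    = 1
  primorial (suc n) = primePart (suc n) * primorial n

  p∤primorial : ∀ {p} → Prime p → ∀ n → n < p → p ∤ primorial n
  p∤primorial pp zero n<p p∣ = p∤n! {n = 0} pp n<p p∣
  p∤primorial pp (suc n) n<p p∣ with euclidsLemma (primePart (suc n)) (primorial n) pp p∣
  ... | inj₂ p∣′ = p∤primorial pp n (<-trans (n<1+n n) n<p) p∣′
  ... | inj₁ p∣′ with prime? (suc n)
  ...   | yes _ = >⇒∤ n<p p∣′
  ...   | no _  = p∤n! {n = 0} pp (≤-<-trans z≤n n<p) p∣′

  -- The numbers after `x` are adjoined one at a time. A new prime `p ≤ 2x` divides `C(2x, x)` but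
  -- not the primorial built so far, so it divides the cofactor `q`.
  primorial-∣ : ∀ x j → j ≤ x → primorial (j + x) ∣ primorial x * centralBinomial x
  primorial-∣ x zero j≤x = m∣m*n (centralBinomial x)
  primorial-∣ x (suc j) j<x with prime? (suc (j + x)) | primorial-∣ x j (<⇒≤ j<x)
  ... | no _   | ih = subst (_∣ primorial x * centralBinomial x) (sym (+-identityʳ _)) ih
  ... | yes pp | divides q eq with euclidsLemma q (primorial (j + x)) pp
        (subst (p ∣_) eq (∣n⇒∣m*n (primorial x) p∣C))
    where
    p = suc (j + x)
    u = x ∸ suc j
    p∣C : p ∣ (x + x) C x
    p∣C = subst (λ y → p ∣ y C x) (begin
      suc j + x + u     ≡⟨ +-comm (suc j + x) u ⟩
      u + (suc j + x)   ≡⟨ +-assoc u (suc j) x ⟨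
      u + suc j + x     ≡⟨ cong (_+ x) (m∸n+n≡m j<x) ⟩
      x + x             ∎) (p∣[p+u]Cv pp (∸-monoʳ-< (s≤s z≤n) j<x) (s≤s (m≤n+m x j)))
      where open ≡-Reasoning
  ...   | inj₁ p∣q = subst (suc (j + x) * primorial (j + x) ∣_) (sym eq) (*-monoˡ-∣ (primorial (j + x)) p∣q)
  ...   | inj₂ p∣′ = contradiction p∣′ (p∤primorial pp (j + x) ≤-refl)

  primorial>0 : ∀ n → 0 < primorial n
  primorial>0 zero    = s≤s z≤n
  primorial>0 (suc n) = *-mono-≤ (primePart>0 (suc n)) (primorial>0 n)

  -- Doubling the argument costs a factor `C(2x, x) ≤ 4^x`. Powers of two suffice because the cutoff
  -- used later is `4^g = 2^(2g)`.
  primorial-2^ : ∀ e → primorial (2 ^ e) ≤ 4 ^ (2 ^ e)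
  primorial-2^ zero = s≤s z≤n
  primorial-2^ (suc e) = begin
    primorial (x + (x + 0))      ≡⟨ cong (λ y → primorial (x + y)) (+-identityʳ x) ⟩
    primorial (x + x)            ≤⟨ ∣⇒≤ {{m*n≢0 (primorial x) (centralBinomial x) {{>-nonZero (primorial>0 x)}} {{>-nonZero (nCk>0 (m≤m+n x x))}}}} (primorial-∣ x x ≤-refl) ⟩
    primorial x * centralBinomial x ≤⟨ *-mono-≤ (primorial-2^ e) (centralBinomial≤4^ x) ⟩
    4 ^ x * 4 ^ x                ≡⟨ ^-distribˡ-+-* 4 x x ⟨
    4 ^ (x + x)                  ≡⟨ cong (λ y → 4 ^ (x + y)) (+-identityʳ x) ⟨
    4 ^ (x + (x + 0))            ∎
    where
    open ≤-Reasoning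
    x = 2 ^ e

  prime-divisor : ∀ n → 1 < n → ∃ λ p → Prime p × p ∣ n
  prime-divisor n 1<n with factorise n {{>-nonZero (<-trans (s≤s z≤n) 1<n)}}
  ... | record { factors = [] ; isFactorisation = n≡1 } = contradiction (subst (1 <_) n≡1 1<n) λ { (s≤s ()) }
  ... | record { factors = p ∷ ps ; isFactorisation = eq ; factorsPrime = pp ∷ _ } =
    p , pp , subst (p ∣_) (sym eq) (m∣m*n (product ps))

  prodUpTo : (ℕ → ℕ) → ℕ → ℕ
  prodUpTo f zero    = 1
  prodUpTo f (suc n) = f (suc n) * prodUpTo f n

  -- Induction on `X`: if `X + 1` is prime, its full power is split off and paid for by `f (X + 1)`;
  -- the cofactor has no prime divisor above `X`. At composite indices positivity of `f` is enough.
  prime-powers-bound : ∀ {f} → (∀ i → 0 < f i) → ∀ X N → 0 < N →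
    (∀ q → Prime q → q ∣ N → q ≤ X) → (∀ q a → Prime q → q ^ a ∣ N → q ^ a ≤ f q) → N ≤ prodUpTo f X
  prime-powers-bound f>0 zero (suc zero) 0<N q≤X q^a≤ = ≤-refl
  prime-powers-bound f>0 zero N@(suc (suc _)) 0<N q≤X q^a≤ with prime-divisor N (s≤s (s≤s z≤n))
  ... | p , pp , p∣N = contradiction (<-≤-trans (prime>1 pp) (q≤X p pp p∣N)) λ ()
  prime-powers-bound {f} f>0 (suc X) N 0<N q≤X q^a≤ with prime? (suc X)
  ... | no ¬pp = ≤-trans
    (prime-powers-bound f>0 X N 0<N (λ q qq q∣N → lower qq (q≤X q qq q∣N)) q^a≤)
    (m≤n*m (prodUpTo f X) (f (suc X)) {{>-nonZero (f>0 (suc X))}})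
    where
    lower : ∀ {q} → Prime q → q ≤ suc X → q ≤ X
    lower qq q≤ with m≤n⇒m<n∨m≡n q≤
    ... | inj₁ (s≤s q≤X′) = q≤X′
    ... | inj₂ refl = contradiction qq ¬pp
  ... | yes pp with prime-power-split pp N 0<N
  ...   | a , u , refl , p∤u = *-mono-≤
    (q^a≤ (suc X) a pp (m∣m*n u))
    (prime-powers-bound f>0 X u u>0 (λ q qq q∣u → lower q∣u (q≤X q qq (∣n⇒∣m*n (suc X ^ a) q∣u)))
      (λ q b qq q∣u → q^a≤ q b qq (∣n⇒∣m*n (suc X ^ a) q∣u)))
    where
    u>0 : 0 < u
    u>0 = n≢0⇒n>0 λ { refl → p∤u (suc X ∣0) }
    lower : ∀ {q} → q ∣ u → q ≤ suc X → q ≤ X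
    lower q∣u q≤ with m≤n⇒m<n∨m≡n q≤
    ... | inj₁ (s≤s q≤X′) = q≤X′
    ... | inj₂ refl = contradiction q∣u p∤u

  -- Each prime up to `s` contributes at most `B`. A prime `q > s` has `q² > B`, so it occurs to the
  -- first power only and is accounted for by the primorial.
  square-free-bound : ∀ {B s} → 0 < B → ∀ X N → 0 < N →
    (∀ q → s < q → B < q * q) →
    (∀ q → Prime q → q ∣ N → q ≤ X) → (∀ q a → Prime q → q ^ a ∣ N → q ^ a ≤ B) → N ≤ B ^ s * primorial X
  square-free-bound {B} {s} 0<B X N 0<N sq q≤X q^a≤ = begin
    N                         ≤⟨ prime-powers-bound f>0 X N 0<N q≤X q^a≤f ⟩
    prodUpTo f X              ≤⟨ prod≤ X ⟩
    B ^ (X ⊓ s) * primorial X ≤⟨ *-monoˡ-≤ (primorial X) (^-monoʳ-≤ B {{>-nonZero 0<B}} (m⊓n≤n X s)) ⟩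
    B ^ s * primorial X       ∎
    where
    open ≤-Reasoning
    f : ℕ → ℕ
    f i with i ≤? s
    ... | yes _ = B
    ... | no _  = primePart i
    f>0 : ∀ i → 0 < f i
    f>0 i with i ≤? s
    ... | yes _ = 0<B
    ... | no _  = primePart>0 i
    exponent≤1 : ∀ q a → Prime q → s < q → q ^ a ≤ B → q ^ a ≤ q
    exponent≤1 q zero qq s<q _ = <⇒≤ (prime>1 qq)
    exponent≤1 q (suc zero) qq s<q _ = ≤-reflexive (*-identityʳ q)
    exponent≤1 q (suc (suc a)) qq s<q q^≤ = contradiction (<-≤-trans (sq q s<q) (begin
      q * q           ≤⟨ m≤m*n (q * q) (q ^ a) {{>-nonZero (p^>0 qq a)}} ⟩
      q * q * q ^ a   ≡⟨ *-assoc q q (q ^ a) ⟩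
      q * (q * q ^ a) ≤⟨ q^≤ ⟩
      B               ∎)) (<-irrefl refl)
    q^a≤f : ∀ q a → Prime q → q ^ a ∣ N → q ^ a ≤ f q
    q^a≤f q a qq q^∣ with q ≤? s
    ... | yes _  = q^a≤ q a qq q^∣
    ... | no q≰s = subst (q ^ a ≤_) (sym (primePart-prime qq)) (exponent≤1 q a qq (≰⇒> q≰s) (q^a≤ q a qq q^∣))
    prod≤ : ∀ X → prodUpTo f X ≤ B ^ (X ⊓ s) * primorial X
    prod≤ zero = ≤-refl
    prod≤ (suc X) with suc X ≤? s
    ... | yes X<s = begin
      B * prodUpTo f X                  ≤⟨ *-monoʳ-≤ B (prod≤ X) ⟩
      B * (B ^ (X ⊓ s) * primorial X)   ≡⟨ *-assoc B (B ^ (X ⊓ s)) (primorial X) ⟨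
      B ^ suc (X ⊓ s) * primorial X     ≡⟨ cong (λ y → B ^ y * primorial X) (trans (cong suc (m≤n⇒m⊓n≡m (<⇒≤ X<s))) (sym (m≤n⇒m⊓n≡m X<s))) ⟩
      B ^ (suc X ⊓ s) * primorial X     ≤⟨ *-monoʳ-≤ (B ^ (suc X ⊓ s)) (m≤n*m (primorial X) (primePart (suc X)) {{>-nonZero (primePart>0 (suc X))}}) ⟩
      B ^ (suc X ⊓ s) * primorial (suc X) ∎
    ... | no X≮s = begin
      primePart (suc X) * prodUpTo f X                 ≤⟨ *-monoʳ-≤ (primePart (suc X)) (prod≤ X) ⟩
      primePart (suc X) * (B ^ (X ⊓ s) * primorial X)  ≡⟨ swap (primePart (suc X)) (B ^ (X ⊓ s)) (primorial X) ⟩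
      B ^ (X ⊓ s) * (primePart (suc X) * primorial X)  ≡⟨ cong (λ y → B ^ y * primorial (suc X)) (trans (m≥n⇒m⊓n≡n (≮⇒≥ X≮s)) (sym (m≥n⇒m⊓n≡n (≰⇒≥ X≮s)))) ⟩
      B ^ (suc X ⊓ s) * primorial (suc X)              ∎
      where
      swap : ∀ a b c → a * (b * c) ≡ b * (a * c)
      swap = solve-∀

  -- With `g = 5 + i`, the left side is the exponent of 4 in `(4^(g+2))^(s+1)` for `s = 2^(g+2)`,
  -- the cost of the small primes. It has to stay below `4^g`.
  exponent-growth : ∀ i → (7 + i) * (2 ^ (7 + i) + 1) < 4 ^ (5 + i)
  -- Here `7·129 = 903 < 1024`. For `g = 4` the inequality fails (`390 > 256`), which is why the
  -- scales start at `g = 5`.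
  exponent-growth zero = m≤m+n 904 120
  exponent-growth (suc i) = begin-strict
    (8 + i) * (2 * 2 ^ (7 + i) + 1)              ≤⟨ *-mono-≤ (+-mono-≤ (m≤m+n 8 6) (m≤n*m i 2)) (≤-trans (+-monoʳ-≤ (2 * 2 ^ (7 + i)) (s≤s (z≤n {1}))) (≤-reflexive (sym (*-distribˡ-+ 2 (2 ^ (7 + i)) 1)))) ⟩
    (14 + 2 * i) * (2 * (2 ^ (7 + i) + 1))       ≡⟨ regroup i (2 ^ (7 + i) + 1) ⟩
    4 * ((7 + i) * (2 ^ (7 + i) + 1))            <⟨ *-monoʳ-< 4 (exponent-growth i) ⟩
    4 * 4 ^ (5 + i)                              ∎
    where
    open ≤-Reasoning
    regroup : ∀ i x → (14 + 2 * i) * (2 * x) ≡ 4 * ((7 + i) * x)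
    regroup = solve-∀

  4^≡2^* : ∀ n → 4 ^ n ≡ 2 ^ n * 2 ^ n
  4^≡2^* n = trans (^-*-assoc 2 2 n) (trans (cong (λ x → 2 ^ (n + x)) (+-identityʳ n)) (^-distribˡ-+-* 2 n n))

  -- Chebyshev-type argument: without prime divisors above 4^g, C(2h,h) would be at most
  -- (2h)^(2^(g+2)) times the primorial of 4^g, contradicting 4^h ≤ 2h·C(2h,h).
  large-prime-divisor : ∀ i h → 2 * 4 ^ (5 + i) ≤ h → h < 8 * 4 ^ (5 + i) →
    ¬ (∀ p → Prime p → p ∣ centralBinomial h → p ≤ 4 ^ (5 + i))
  large-prime-divisor i zero 2x≤h h<8x small =
    contradiction (<-≤-trans (m^n>0 4 (5 + i)) (≤-trans (m≤n*m (4 ^ (5 + i)) 2) 2x≤h)) λ ()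
  large-prime-divisor i h@(suc h′) 2x≤h h<8x small = contradiction h<h (<-irrefl refl)
    where
    open ≤-Reasoning
    g = 5 + i
    x = 4 ^ g
    -- Chosen so that `s² = 16·4^g` exceeds `2h`: primes above `s` then divide `C(2h, h)` at most
    -- once.
    s = 2 ^ (2 + g)
    B = h + h
    N = centralBinomial h
    B<s² : B < 4 ^ (2 + g)
    B<s² = begin-strict
      h + h             <⟨ +-mono-< h<8x h<8x ⟩
      8 * x + 8 * x     ≡⟨ dbl x ⟩
      4 * (4 * x)       ∎
      where
      dbl : ∀ x → 8 * x + 8 * x ≡ 4 * (4 * x)
      dbl = solve-∀
    sq : ∀ q → s < q → B < q * q
    sq q s<q = begin-strict
      B              <⟨ B<s² ⟩
      4 ^ (2 + g)    ≡⟨ 4^≡2^* (2 + g) ⟩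
      s * s          ≤⟨ *-mono-≤ (<⇒≤ s<q) (<⇒≤ s<q) ⟩
      q * q          ∎
    primorial≤ : primorial x ≤ 4 ^ x
    primorial≤ = subst (λ y → primorial y ≤ 4 ^ y) (sym (^-*-assoc 2 2 g)) (primorial-2^ (2 * g))
    N≤ : N ≤ B ^ s * 4 ^ x
    N≤ = begin
      N                   ≤⟨ square-free-bound (s≤s z≤n) x N (nCk>0 (m≤m+n h h)) sq small
                              (λ q a qq → p^a∣nCk⇒p^a≤n qq (m≤m+n h′ h) a) ⟩
      B ^ s * primorial x ≤⟨ *-monoʳ-≤ (B ^ s) primorial≤ ⟩
      B ^ s * 4 ^ x       ∎
    4^h≤ : 4 ^ h ≤ 4 ^ ((2 + g) * (s + 1) + x)
    4^h≤ = begin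
      4 ^ h                              ≤⟨ 4^≤2h*centralBinomial h′ ⟩
      B * N                              ≤⟨ *-monoʳ-≤ B N≤ ⟩
      B * (B ^ s * 4 ^ x)                ≡⟨ *-assoc B (B ^ s) (4 ^ x) ⟨
      B ^ suc s * 4 ^ x                  ≡⟨ cong (λ y → B ^ y * 4 ^ x) (+-comm 1 s) ⟩
      B ^ (s + 1) * 4 ^ x                ≤⟨ *-monoˡ-≤ (4 ^ x) (^-monoˡ-≤ (s + 1) (<⇒≤ B<s²)) ⟩
      (4 ^ (2 + g)) ^ (s + 1) * 4 ^ x    ≡⟨ cong (_* 4 ^ x) (^-*-assoc 4 (2 + g) (s + 1)) ⟩
      4 ^ ((2 + g) * (s + 1)) * 4 ^ x    ≡⟨ ^-distribˡ-+-* 4 ((2 + g) * (s + 1)) x ⟨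
      4 ^ ((2 + g) * (s + 1) + x)        ∎
    h<h : h < h
    h<h = begin-strict
      h                            ≤⟨ ≮⇒≥ (λ lt → <⇒≱ (^-monoʳ-< 4 (s≤s (s≤s z≤n)) lt) 4^h≤) ⟩
      (2 + g) * (s + 1) + x        <⟨ +-monoˡ-< x (exponent-growth i) ⟩
      x + x                        ≡⟨ cong (x +_) (+-identityʳ x) ⟨
      2 * x                        ≤⟨ 2x≤h ⟩
      h                            ∎

  -- The windows from `2·4^g` to `8·4^g = 2·4^(g+1)` tile all numbers from `2·4^5 = 2048` on.
  scale-of : ∀ d → ∃ λ i → 2 * 4 ^ (5 + i) ≤ d + 2048 × d + 2048 < 8 * 4 ^ (5 + i)
  scale-of zero = 0 , ≤-refl , m≤m+n 2049 6143
  scale-of (suc d) with scale-of d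
  ... | i , lo , hi with suc (d + 2048) <? 8 * 4 ^ (5 + i)
  ...   | yes hi′ = i , m≤n⇒m≤1+n lo , hi′
  ...   | no ¬hi′ = suc i , ≤-trans (≤-reflexive (regroup (4 ^ (5 + i)))) (≮⇒≥ ¬hi′) , (begin-strict
      suc (d + 2048)             ≤⟨ hi ⟩
      8 * 4 ^ (5 + i)            <⟨ *-monoʳ-< 8 (subst (4 ^ (5 + i) <_) (*-comm (4 ^ (5 + i)) 4) (m<m*n (4 ^ (5 + i)) 4 {{m^n≢0 4 (5 + i)}} (s≤s (s≤s z≤n)))) ⟩
      8 * (4 * 4 ^ (5 + i))      ∎)
    where
    open ≤-Reasoning
    regroup : ∀ x → 2 * (4 * x) ≡ 8 * x
    regroup = solve-∀

  -- Adding `h = up + v` to itself in base `p` produces no carry, so `C(2h, h) ≡ C(2u, u)·C(2v, v)`,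
  -- and both factors have upper entries below `p`.
  p∤centralBinomial : ∀ {p} u v → Prime p → u + u < p → v + v < p → p ∤ centralBinomial (u * p + v)
  p∤centralBinomial {p} u v pp u<p v<p p∣ with lucas pp (u + u) u v<p (≤-<-trans (m≤m+n v v) v<p)
  ... | q , e = [ p∤nCk pp u<p (m≤m+n u u) , p∤nCk pp v<p (m≤m+n v v) ]′
    (euclidsLemma (centralBinomial u) (centralBinomial v) pp
      (∣m+n∣m⇒∣n (subst (p ∣_) (trans (cong (_C (u * p + v)) (regroup u v p)) (trans e (+-comm _ (p * q)))) p∣) (m∣m*n q)))
    where
    regroup : ∀ u v p → (u * p + v) + (u * p + v) ≡ (u + u) * p + (v + v)
    regroup = solve-∀

  -- Subsets of a given size

  private
    variable
      n : ℕ

  -- Used in two roles: with `U = ⊤` it is the hard family, and with `U` of size `K + p + m` it is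
  -- the range of the sum in the descent.
  subsetsOf : Subset n → ℕ → List (Subset n)
  subsetsOf []            zero    = [] ∷ []
  subsetsOf []            (suc k) = []
  subsetsOf (outside ∷ U) k       = map (outside ∷_) (subsetsOf U k)
  subsetsOf (inside ∷ U)  zero    = map (outside ∷_) (subsetsOf U zero)
  subsetsOf (inside ∷ U)  (suc k) = map (outside ∷_) (subsetsOf U (suc k)) ++ map (inside ∷_) (subsetsOf U k)

  subsetsOf-sound : ∀ (U : Subset n) k → All (λ A → ∣ A ∣ ≡ k × A ⊆ U) (subsetsOf U k)
  subsetsOf-sound [] zero = (refl , λ ()) ∷ []
  subsetsOf-sound [] (suc k) = []
  subsetsOf-sound (s ∷ U) k = cases s k
    where
    outside∷ : ∀ {s A k} → ∣ A ∣ ≡ k × A ⊆ U → ∣ outside ∷ A ∣ ≡ k × outside ∷ A ⊆ s ∷ U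
    outside∷ (size , A⊆U) = size , out⊆ A⊆U
    inside∷ : ∀ {A k} → ∣ A ∣ ≡ k × A ⊆ U → ∣ inside ∷ A ∣ ≡ suc k × inside ∷ A ⊆ inside ∷ U
    inside∷ (size , A⊆U) = cong suc size , in⊆in A⊆U
    cases : ∀ s k → All (λ A → ∣ A ∣ ≡ k × A ⊆ s ∷ U) (subsetsOf (s ∷ U) k)
    cases outside k       = All.map⁺ (All.map outside∷ (subsetsOf-sound U k))
    cases inside  zero    = All.map⁺ (All.map outside∷ (subsetsOf-sound U zero))
    cases inside  (suc k) = All.++⁺ (All.map⁺ (All.map outside∷ (subsetsOf-sound U (suc k))))
                                    (All.map⁺ (All.map inside∷ (subsetsOf-sound U k)))

  -- Completeness is phrased as a transfer of `All P`, the form in which `Secting` supplies its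
  -- information.
  subsetsOf⊤-complete : ∀ (P : Subset n → Set) k → All P (subsetsOf ⊤ k) → ∀ A → ∣ A ∣ ≡ k → P A
  subsetsOf⊤-complete P zero (pA ∷ []) [] refl = pA
  subsetsOf⊤-complete P zero all (outside ∷ A) eq = subsetsOf⊤-complete (P ∘ (outside ∷_)) zero (All.map⁻ all) A eq
  subsetsOf⊤-complete P (suc k) all (outside ∷ A) eq =
    subsetsOf⊤-complete (P ∘ (outside ∷_)) (suc k) (All.map⁻ (All.++⁻ˡ _ all)) A eq
  subsetsOf⊤-complete P (suc k) all (inside ∷ A) eq =
    subsetsOf⊤-complete (P ∘ (inside ∷_)) k (All.map⁻ (All.++⁻ʳ (map (outside ∷_) (subsetsOf ⊤ (suc k))) all)) A (suc-injective eq)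

  superset-of-size : ∀ (y : Subset n) s → ∣ y ∣ ≤ s → s ≤ n → ∃ λ U → y ⊆ U × ∣ U ∣ ≡ s
  superset-of-size [] zero y≤s s≤n = [] , (λ ()) , refl
  superset-of-size (inside ∷ y) (suc s) (s≤s y≤s) (s≤s s≤n) with superset-of-size y s y≤s s≤n
  ... | U , y⊆U , size = inside ∷ U , in⊆in y⊆U , cong suc size
  superset-of-size {suc n} (outside ∷ y) s y≤s s≤n with m≤n⇒m<n∨m≡n s≤n
  ... | inj₂ refl = ⊤ , ⊆-max (outside ∷ y) , ∣⊤∣≡n (suc n)
  ... | inj₁ (s≤s s≤n′) with superset-of-size y s y≤s s≤n′
  ...   | U , y⊆U , size = outside ∷ U , out⊆ y⊆U , size

  -- Sums over lists

  sumOver : {X : Set} → List X → (X → ℕ) → ℕ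
  sumOver L f = listSum (map f L)

  module _ {X : Set} where

    sumOver-cong : ∀ (L : List X) {f g : X → ℕ} → f ≗ g → sumOver L f ≡ sumOver L g
    sumOver-cong L f≗g = cong listSum (map-cong f≗g L)

    sumOver-zero : ∀ {L : List X} {f : X → ℕ} → All (λ A → f A ≡ 0) L → sumOver L f ≡ 0
    sumOver-zero []         = refl
    sumOver-zero (eq ∷ eqs) = cong₂ _+_ eq (sumOver-zero eqs)

    sumOver-∣ : ∀ {p} {L : List X} {f : X → ℕ} → All (λ A → p ∣ f A) L → p ∣ sumOver L f
    sumOver-∣ {p} []   = p ∣0
    sumOver-∣ (d ∷ ds) = ∣m∣n⇒∣m+n d (sumOver-∣ ds)

    sumOver-*ˡ : ∀ (L : List X) c f → sumOver L (λ A → c * f A) ≡ c * sumOver L f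
    sumOver-*ˡ []      c f = sym (*-zeroʳ c)
    sumOver-*ˡ (A ∷ L) c f = trans (cong (c * f A +_) (sumOver-*ˡ L c f)) (sym (*-distribˡ-+ c (f A) (sumOver L f)))

    sumOver-sum : ∀ (L : List X) (f : Fin n → X → ℕ) → sumOver L (λ A → sum λ j → f j A) ≡ sum λ j → sumOver L (f j)
    sumOver-sum {n} []  f = sym (sum-replicate-zero n)
    sumOver-sum (A ∷ L) f = trans (cong (sum (λ j → f j A) +_) (sumOver-sum L f))
      (sym (∑-distrib-+ (λ j → f j A) (λ j → sumOver L (f j))))

    sumOver-map : ∀ {Y : Set} (L : List Y) (h : Y → X) f → sumOver (map h L) f ≡ sumOver L (f ∘ h)
    sumOver-map L h f = cong listSum (sym (map-∘ L))

    sumOver-++ : ∀ (L L′ : List X) f → sumOver (L ++ L′) f ≡ sumOver L f + sumOver L′ f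
    sumOver-++ L L′ f = trans (cong listSum (map-++ f L L′)) (sum-++ (map f L) (map f L′))

  sum-∣ : ∀ {p} (f : Fin n → ℕ) → (∀ j → p ∣ f j) → p ∣ sum f
  sum-∣ {zero}  {p} f d = p ∣0
  sum-∣ {suc n} f d = ∣m∣n⇒∣m+n (d zero) (sum-∣ (f ∘ suc) (d ∘ suc))

  -- Multilinear monomials and their sums over subsets of fixed size

  bit : Side → ℕ
  bit inside  = 1
  bit outside = 0

  -- The monomial with index set `T`, evaluated at the 0/1 vector of `A`; equivalently the indicator
  -- of `T ⊆ A`.
  χ : Subset n → Subset n → ℕ
  χ []            []            = 1
  χ (outside ∷ T) (s ∷ A)       = χ T A
  χ (inside ∷ T)  (inside ∷ A)  = χ T A
  χ (inside ∷ T)  (outside ∷ A) = 0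

  χ≡0⊎⊆ : ∀ (T A : Subset n) → χ T A ≡ 0 ⊎ T ⊆ A
  χ≡0⊎⊆ [] [] = inj₂ λ ()
  χ≡0⊎⊆ (inside ∷ T) (outside ∷ A) = inj₁ refl
  χ≡0⊎⊆ (outside ∷ T) (s ∷ A) with χ≡0⊎⊆ T A
  ... | inj₁ eq  = inj₁ eq
  ... | inj₂ T⊆A = inj₂ (out⊆ T⊆A)
  χ≡0⊎⊆ (inside ∷ T) (inside ∷ A) with χ≡0⊎⊆ T A
  ... | inj₁ eq  = inj₁ eq
  ... | inj₂ T⊆A = inj₂ (in⊆in T⊆A)

  -- Since `x_j² = x_j` on 0/1 vectors, this also covers the case that `j` already lies in `T`.
  χ-insert : ∀ (T A : Subset n) j → χ T A * bit (lookup A j) ≡ χ (T [ j ]≔ inside) A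
  χ-insert (outside ∷ T) (inside ∷ A)  zero = *-identityʳ (χ T A)
  χ-insert (outside ∷ T) (outside ∷ A) zero = *-zeroʳ (χ T A)
  χ-insert (inside ∷ T)  (inside ∷ A)  zero = *-identityʳ (χ T A)
  χ-insert (inside ∷ T)  (outside ∷ A) zero = refl
  χ-insert (outside ∷ T) (s ∷ A)       (suc j) = χ-insert T A j
  χ-insert (inside ∷ T)  (inside ∷ A)  (suc j) = χ-insert T A j
  χ-insert (inside ∷ T)  (outside ∷ A) (suc j) = refl

  ∣insert∣≥ : ∀ (T : Subset n) j → ∣ T ∣ ≤ ∣ T [ j ]≔ inside ∣
  ∣insert∣≥ (outside ∷ T) zero = n≤1+n _
  ∣insert∣≥ (inside ∷ T) zero = ≤-refl
  ∣insert∣≥ (outside ∷ T) (suc j) = ∣insert∣≥ T j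
  ∣insert∣≥ (inside ∷ T) (suc j) = s≤s (∣insert∣≥ T j)

  ∣insert∣≤ : ∀ (T : Subset n) j → ∣ T [ j ]≔ inside ∣ ≤ suc ∣ T ∣
  ∣insert∣≤ (outside ∷ T) zero = ≤-refl
  ∣insert∣≤ (inside ∷ T) zero = n≤1+n _
  ∣insert∣≤ (outside ∷ T) (suc j) = ∣insert∣≤ T j
  ∣insert∣≤ (inside ∷ T) (suc j) = s≤s (∣insert∣≤ T j)

  insert-new : ∀ (T : Subset n) j → lookup T j ≡ outside → ∣ T [ j ]≔ inside ∣ ≡ suc ∣ T ∣
  insert-new (outside ∷ T) zero eq = refl
  insert-new (outside ∷ T) (suc j) eq = insert-new T j eq
  insert-new (inside ∷ T) (suc j) eq = cong suc (insert-new T j eq)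

  insert-old : ∀ (T : Subset n) j → lookup T j ≡ inside → T [ j ]≔ inside ≡ T
  insert-old (inside ∷ T) zero eq = refl
  insert-old (s ∷ T) (suc j) eq = cong (s ∷_) (insert-old T j eq)

  count-too-small : ∀ (T U : Subset n) k → k < ∣ T ∣ → sumOver (subsetsOf U k) (χ T) ≡ 0
  count-too-small T U k k<T = sumOver-zero (All.map vanish (subsetsOf-sound U k))
    where
    vanish : ∀ {A} → ∣ A ∣ ≡ k × A ⊆ U → χ T A ≡ 0
    vanish {A} (size , _) with χ≡0⊎⊆ T A
    ... | inj₁ eq  = eq
    ... | inj₂ T⊆A = contradiction (≤-trans (p⊆q⇒∣p∣≤∣q∣ T⊆A) (≤-reflexive size)) (<⇒≱ k<T)

  count-⊈ : ∀ (T U : Subset n) k → ¬ T ⊆ U → sumOver (subsetsOf U k) (χ T) ≡ 0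
  count-⊈ T U k T⊈U = sumOver-zero (All.map vanish (subsetsOf-sound U k))
    where
    vanish : ∀ {A} → ∣ A ∣ ≡ k × A ⊆ U → χ T A ≡ 0
    vanish {A} (_ , A⊆U) with χ≡0⊎⊆ T A
    ... | inj₁ eq  = eq
    ... | inj₂ T⊆A = contradiction (λ {x} → ⊆-trans T⊆A A⊆U {x}) T⊈U

  -- The sets counted arise by choosing `a` further elements among the `b` elements of `U` outside
  -- `T`. Passing `a` and `b` with equations avoids truncated subtraction in the induction.
  count-⊆ : ∀ (T U : Subset n) k a b → T ⊆ U → k ≡ ∣ T ∣ + a → ∣ U ∣ ≡ ∣ T ∣ + b →
    sumOver (subsetsOf U k) (χ T) ≡ b C a
  count-⊆ [] [] zero .zero zero T⊆U refl refl = refl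
  count-⊆ [] [] (suc k) (suc .k) zero T⊆U refl refl = refl
  count-⊆ (outside ∷ T) (outside ∷ U) k a b T⊆U k≡ U≡ =
    trans (sumOver-map (subsetsOf U k) (outside ∷_) (χ (outside ∷ T))) (count-⊆ T U k a b (drop-∷-⊆ T⊆U) k≡ U≡)
  count-⊆ (inside ∷ T) (outside ∷ U) k a b T⊆U k≡ U≡ with T⊆U here
  ... | ()
  count-⊆ (inside ∷ T) (inside ∷ U) (suc k) a b T⊆U k≡ U≡ = begin
    sumOver (map (outside ∷_) (subsetsOf U (suc k)) ++ map (inside ∷_) (subsetsOf U k)) (χ (inside ∷ T))
      ≡⟨ sumOver-++ (map (outside ∷_) (subsetsOf U (suc k))) _ (χ (inside ∷ T)) ⟩
    sumOver (map (outside ∷_) (subsetsOf U (suc k))) (χ (inside ∷ T)) + sumOver (map (inside ∷_) (subsetsOf U k)) (χ (inside ∷ T))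
      ≡⟨ cong₂ _+_ (sumOver-map (subsetsOf U (suc k)) (outside ∷_) (χ (inside ∷ T))) (sumOver-map (subsetsOf U k) (inside ∷_) (χ (inside ∷ T))) ⟩
    sumOver (subsetsOf U (suc k)) (λ _ → 0) + sumOver (subsetsOf U k) (χ T)
      ≡⟨ cong₂ _+_ (sumOver-zero (All.universal (λ _ → refl) (subsetsOf U (suc k)))) (count-⊆ T U k a b (drop-∷-⊆ T⊆U) (suc-injective k≡) (suc-injective U≡)) ⟩
    b C a ∎
    where open ≡-Reasoning
  count-⊆ (outside ∷ T) (inside ∷ U) k a zero T⊆U k≡ U≡ =
    contradiction (≤-trans (≤-reflexive (trans U≡ (+-identityʳ _))) (p⊆q⇒∣p∣≤∣q∣ (drop-∷-⊆ T⊆U))) (<-irrefl refl)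
  count-⊆ (outside ∷ T) (inside ∷ U) zero a (suc b) T⊆U k≡ U≡ with m+n≡0⇒n≡0 ∣ T ∣ (sym k≡)
  ... | refl = trans (sumOver-map (subsetsOf U zero) (outside ∷_) (χ (outside ∷ T)))
    (count-⊆ T U zero zero b (drop-∷-⊆ T⊆U) k≡ (suc-injective (trans U≡ (+-suc ∣ T ∣ b))))
  count-⊆ (outside ∷ T) (inside ∷ U) (suc k) a (suc b) T⊆U k≡ U≡ = begin
    sumOver (map (outside ∷_) (subsetsOf U (suc k)) ++ map (inside ∷_) (subsetsOf U k)) (χ (outside ∷ T))
      ≡⟨ sumOver-++ (map (outside ∷_) (subsetsOf U (suc k))) _ (χ (outside ∷ T)) ⟩
    sumOver (map (outside ∷_) (subsetsOf U (suc k))) (χ (outside ∷ T)) + sumOver (map (inside ∷_) (subsetsOf U k)) (χ (outside ∷ T))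
      ≡⟨ cong₂ _+_ (sumOver-map (subsetsOf U (suc k)) (outside ∷_) (χ (outside ∷ T))) (sumOver-map (subsetsOf U k) (inside ∷_) (χ (outside ∷ T))) ⟩
    sumOver (subsetsOf U (suc k)) (χ T) + sumOver (subsetsOf U k) (χ T)
      ≡⟨ cong (_+ sumOver (subsetsOf U k) (χ T)) (count-⊆ T U (suc k) a b (drop-∷-⊆ T⊆U) k≡ U≡′) ⟩
    b C a + sumOver (subsetsOf U k) (χ T)
      ≡⟨ rest a k≡ ⟩
    suc b C a ∎
    where
    open ≡-Reasoning
    U≡′ : ∣ U ∣ ≡ ∣ T ∣ + b
    U≡′ = suc-injective (trans U≡ (+-suc ∣ T ∣ b))
    rest : ∀ a → suc k ≡ ∣ T ∣ + a → b C a + sumOver (subsetsOf U k) (χ T) ≡ suc b C a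
    -- With `a = 0` the sets containing the new element have only `k < ∣ T ∣` places left for `T`,
    -- so their sum is zero.
    rest zero eq = cong suc (count-too-small T U k (≤-reflexive (trans eq (+-identityʳ _))))
    rest (suc a) eq = begin
      b C suc a + sumOver (subsetsOf U k) (χ T)
        ≡⟨ cong (λ x → b C suc a + x) (count-⊆ T U k a b (drop-∷-⊆ T⊆U) (suc-injective (trans eq (+-suc ∣ T ∣ a))) U≡′) ⟩
      b C suc a + b C a  ≡⟨ +-comm (b C suc a) (b C a) ⟩
      b C a + b C suc a  ≡⟨ pascal b a ⟨
      suc b C suc a      ∎

  -- Products of linear forms and the descent in weight modulo `p`

  linear : (Fin n → ℕ) → Subset n → ℕ
  linear u A = sum λ j → u j * bit (lookup A j)

  linears : List (Fin n → ℕ) → Subset n → ℕ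
  linears us A = product (map (λ u → linear u A) us)

  moment : List (Subset n) → List (Fin n → ℕ) → Subset n → ℕ
  moment L us T = sumOver L λ A → χ T A * linears us A

  -- Expanding one linear form moves its index `j` into the monomial. Induction on `us` by this rule
  -- replaces an explicit expansion of the product polynomial.
  moment-∷ : ∀ (L : List (Subset n)) u us T →
    moment L (u ∷ us) T ≡ sum λ j → u j * moment L us (T [ j ]≔ inside)
  moment-∷ L u us T = begin
    sumOver L (λ A → χ T A * (linear u A * linears us A))
      ≡⟨ sumOver-cong L expand ⟩
    sumOver L (λ A → sum λ j → u j * (χ (T [ j ]≔ inside) A * linears us A))
      ≡⟨ sumOver-sum L (λ j A → u j * (χ (T [ j ]≔ inside) A * linears us A)) ⟩
    sum (λ j → sumOver L (λ A → u j * (χ (T [ j ]≔ inside) A * linears us A)))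
      ≡⟨ sum-cong-≗ (λ j → sumOver-*ˡ L (u j) (λ A → χ (T [ j ]≔ inside) A * linears us A)) ⟩
    sum (λ j → u j * moment L us (T [ j ]≔ inside)) ∎
    where
    open ≡-Reasoning
    regroup : ∀ x a b P → (x * (a * b)) * P ≡ a * ((x * b) * P)
    regroup = solve-∀
    expand : ∀ A → χ T A * (linear u A * linears us A) ≡ sum λ j → u j * (χ (T [ j ]≔ inside) A * linears us A)
    expand A = begin
      χ T A * (linear u A * linears us A)
        ≡⟨ *-assoc (χ T A) (linear u A) (linears us A) ⟨
      χ T A * linear u A * linears us A
        ≡⟨ cong (_* linears us A) (*-distribˡ-sum (χ T A) (λ j → u j * bit (lookup A j))) ⟩
      sum (λ j → χ T A * (u j * bit (lookup A j))) * linears us A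
        ≡⟨ *-distribʳ-sum (linears us A) (λ j → χ T A * (u j * bit (lookup A j))) ⟩
      sum (λ j → χ T A * (u j * bit (lookup A j)) * linears us A)
        ≡⟨ sum-cong-≗ (λ j → trans (regroup (χ T A) (u j) (bit (lookup A j)) (linears us A))
                                   (cong (λ x → u j * (x * linears us A)) (χ-insert T A j))) ⟩
      sum (λ j → u j * (χ (T [ j ]≔ inside) A * linears us A)) ∎

  moment-[] : ∀ (L : List (Subset n)) T → moment L [] T ≡ sumOver L (χ T)
  moment-[] L T = sumOver-cong L λ A → *-identityʳ (χ T A)

  module Descent {n p K m : ℕ} (pp : Prime p) (m<p : m < p) (U : Subset n) (∣U∣≡ : ∣ U ∣ ≡ K + p + m) where

    L : List (Subset n)
    L = subsetsOf U (K + p)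

    -- Each expanded form enlarges `T` by at most one element, so the bound on `∣ T ∣ + length us`
    -- keeps the final size between `K + 1` and `K + m`.
    p∣moment : ∀ us T → K < ∣ T ∣ → ∣ T ∣ + length us ≤ K + m → p ∣ moment L us T
    p∣moment [] T K<T T≤ with T ⊆? U
    ... | no T⊈U = subst (p ∣_) (sym (trans (moment-[] L T) (count-⊈ T U (K + p) T⊈U))) (p ∣0)
    ... | yes T⊆U = subst (p ∣_) (sym (trans (moment-[] L T) (count-⊆ T U (K + p) (p ∸ t) (p + (m ∸ t)) T⊆U K+p≡ U≡)))
        -- The count is `C(p + (m - t), p - t)`: `m < p` gives `m - t < p - t`, and `t ≥ 1` gives
        -- `p - t < p`.
        (p∣[p+u]Cv pp (∸-monoˡ-< m<p t≤m) (∸-monoʳ-< (m<n⇒0<n∸m K<T) (≤-trans t≤m (<⇒≤ m<p))))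
      where
      open ≡-Reasoning
      t = ∣ T ∣ ∸ K
      K+t≡ : K + t ≡ ∣ T ∣
      K+t≡ = m+[n∸m]≡n (<⇒≤ K<T)
      t≤m : t ≤ m
      t≤m = +-cancelˡ-≤ K t m (subst (_≤ K + m) (sym K+t≡) (subst (_≤ K + m) (+-identityʳ _) T≤))
      K+p≡ : K + p ≡ ∣ T ∣ + (p ∸ t)
      K+p≡ = begin
        K + p               ≡⟨ cong (K +_) (m+[n∸m]≡n (≤-trans t≤m (<⇒≤ m<p))) ⟨
        K + (t + (p ∸ t))   ≡⟨ +-assoc K t (p ∸ t) ⟨
        K + t + (p ∸ t)     ≡⟨ cong (_+ (p ∸ t)) K+t≡ ⟩
        ∣ T ∣ + (p ∸ t)     ∎
      regroup : ∀ K p t x → K + p + (t + x) ≡ K + t + (p + x)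
      regroup = solve-∀
      U≡ : ∣ U ∣ ≡ ∣ T ∣ + (p + (m ∸ t))
      U≡ = begin
        ∣ U ∣                     ≡⟨ ∣U∣≡ ⟩
        K + p + m                 ≡⟨ cong (K + p +_) (m+[n∸m]≡n t≤m) ⟨
        K + p + (t + (m ∸ t))     ≡⟨ regroup K p t (m ∸ t) ⟩
        K + t + (p + (m ∸ t))     ≡⟨ cong (_+ (p + (m ∸ t))) K+t≡ ⟩
        ∣ T ∣ + (p + (m ∸ t))     ∎
    p∣moment (u ∷ us) T K<T T≤ = subst (p ∣_) (sym (moment-∷ L u us T)) (sum-∣ _ λ j → ∣n⇒∣m*n (u j)
      (p∣moment us (T [ j ]≔ inside) (<-≤-trans K<T (∣insert∣≥ T j))
        (≤-trans (+-monoˡ-≤ (length us) (∣insert∣≤ T j)) (subst (_≤ K + m) (+-suc ∣ T ∣ (length us)) T≤))))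

    -- When the first form is expanded at `y`, indices outside `y` give moments divisible by `p`,
    -- while indices inside `y` leave the monomial unchanged. Modulo `p` the form therefore factors
    -- out as its value at `y`. After all forms only `C(p+m, p)` remains, which is prime to `p`.
    p∣moment⇒p∣linear : ∀ y → ∣ y ∣ ≡ K → y ⊆ U → ∀ us → length us ≤ m →
      p ∣ moment L us y → Any (λ u → p ∣ linear u y) us
    p∣moment⇒p∣linear y y≡K y⊆U [] _ p∣ =
      contradiction (subst (p ∣_) (trans (moment-[] L y) (count-⊆ y U (K + p) p (p + m) y⊆U (cong (_+ p) (sym y≡K)) U≡)) p∣)
        (p∤[p+r]Cp pp m<p)
      where
      U≡ : ∣ U ∣ ≡ ∣ y ∣ + (p + m)
      U≡ = trans ∣U∣≡ (trans (+-assoc K p m) (cong (_+ (p + m)) (sym y≡K)))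
    p∣moment⇒p∣linear y y≡K y⊆U (u ∷ us) us<m p∣ with euclidsLemma (linear u y) (moment L us y) pp p∣product
      where
      open ≡-Reasoning
      others : Fin n → ℕ
      others j with lookup y j
      ... | inside  = 0
      ... | outside = u j * moment L us (y [ j ]≔ inside)
      p∣others : ∀ j → p ∣ others j
      p∣others j with lookup y j in eq
      ... | inside  = p ∣0
      ... | outside = ∣n⇒∣m*n (u j) (p∣moment us (y [ j ]≔ inside)
        (≤-reflexive (trans (cong suc (sym y≡K)) (sym (insert-new y j eq))))
        (≤-trans (≤-reflexive (trans (cong (_+ length us) (trans (insert-new y j eq) (cong suc y≡K))) (sym (+-suc K (length us))))) (+-monoʳ-≤ K us<m)))
      split : ∀ j → u j * moment L us (y [ j ]≔ inside) ≡ others j + u j * bit (lookup y j) * moment L us y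
      split j with lookup y j in eq
      ... | inside  = trans (cong (λ z → u j * moment L us z) (insert-old y j eq)) (cong (_* moment L us y) (sym (*-identityʳ (u j))))
      ... | outside = sym (trans (cong (λ z → u j * moment L us (y [ j ]≔ inside) + z * moment L us y) (*-zeroʳ (u j))) (+-identityʳ _))
      total : moment L (u ∷ us) y ≡ sum others + linear u y * moment L us y
      total = begin
        moment L (u ∷ us) y                              ≡⟨ moment-∷ L u us y ⟩
        sum (λ j → u j * moment L us (y [ j ]≔ inside))  ≡⟨ sum-cong-≗ split ⟩
        sum (λ j → others j + u j * bit (lookup y j) * moment L us y)
          ≡⟨ ∑-distrib-+ others (λ j → u j * bit (lookup y j) * moment L us y) ⟩
        sum others + sum (λ j → u j * bit (lookup y j) * moment L us y)
          ≡⟨ cong (sum others +_) (*-distribʳ-sum (moment L us y) (λ j → u j * bit (lookup y j))) ⟨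
        sum others + linear u y * moment L us y          ∎
      p∣product : p ∣ linear u y * moment L us y
      p∣product = ∣m+n∣m⇒∣n (subst (p ∣_) total p∣) (sum-∣ others p∣others)
    ... | inj₁ p∣u  = here p∣u
    ... | inj₂ p∣us = there (p∣moment⇒p∣linear y y≡K y⊆U us (<⇒≤ us<m) p∣us)

  p∣linears : ∀ {p} us (A : Subset n) → Any (λ u → p ∣ linear u A) us → p ∣ linears us A
  p∣linears (u ∷ us) A (here p∣u)   = ∣m⇒∣m*n (linears us A) p∣u
  p∣linears (u ∷ us) A (there p∣us) = ∣n⇒∣m*n (linear u A) (p∣linears us A p∣us)

  descend : ∀ {p K} → Prime p → (us : List (Fin n → ℕ)) → length us < p → K + p + length us ≤ n →
    (∀ A → ∣ A ∣ ≡ K + p → Any (λ u → p ∣ linear u A) us) →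
    ∀ y → ∣ y ∣ ≡ K → Any (λ u → p ∣ linear u y) us
  descend {n} {p} {K} pp us m<p room hits y y≡K
    with superset-of-size y (K + p + length us) (subst (_≤ K + p + length us) (sym y≡K) (≤-trans (m≤m+n K p) (m≤m+n (K + p) _))) room
  ... | U , y⊆U , U≡ = p∣moment⇒p∣linear y y≡K y⊆U us ≤-refl
    (sumOver-∣ (All.map (λ {A} (size , _) → ∣n⇒∣m*n (χ y A) (p∣linears us A (hits A size))) (subsetsOf-sound U (K + p))))
    where open Descent pp m<p U U≡

  descend* : ∀ {p} K t → Prime p → (us : List (Fin n → ℕ)) → length us < p → t * p + K + length us ≤ n →
    (∀ A → ∣ A ∣ ≡ t * p + K → Any (λ u → p ∣ linear u A) us) →
    ∀ y → ∣ y ∣ ≡ K → Any (λ u → p ∣ linear u y) us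
  descend* K zero pp us m<p room hits = hits
  descend* {n} {p} K (suc t) pp us m<p room hits =
    descend* K t pp us m<p (≤-trans (+-monoˡ-≤ (length us) (≤-trans (m≤m+n (t * p + K) p) (≤-reflexive regroup))) room)
      (descend pp us m<p (≤-trans (≤-reflexive (cong (_+ length us) regroup)) room) (λ A size → hits A (trans size regroup)))
    where
    regroup : t * p + K + p ≡ p + t * p + K
    regroup = trans (+-comm (t * p + K) p) (sym (+-assoc p (t * p) K))

  -- From sections to linear forms; parity arguments

  ∣A∩B∣+∣A∩∁B∣ : ∀ (A B : Subset n) → ∣ A ∩ B ∣ + ∣ A ∩ ∁ B ∣ ≡ ∣ A ∣
  ∣A∩B∣+∣A∩∁B∣ [] [] = refl
  ∣A∩B∣+∣A∩∁B∣ (outside ∷ A) (b ∷ B) = ∣A∩B∣+∣A∩∁B∣ A B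
  ∣A∩B∣+∣A∩∁B∣ (inside ∷ A) (inside ∷ B) = cong suc (∣A∩B∣+∣A∩∁B∣ A B)
  ∣A∩B∣+∣A∩∁B∣ (inside ∷ A) (outside ∷ B) = trans (+-suc _ _) (cong suc (∣A∩B∣+∣A∩∁B∣ A B))

  -- With q = p − 1 this is the ±1 vector of B modulo p.
  signs : ℕ → Subset n → Fin n → ℕ
  signs q B j with lookup B j
  ... | inside  = 1
  ... | outside = q

  linear-signs : ∀ q (A B : Subset n) → linear (signs q B) A ≡ ∣ A ∩ B ∣ + q * ∣ A ∩ ∁ B ∣
  linear-signs q [] [] = sym (*-zeroʳ q)
  linear-signs q (outside ∷ A) (inside ∷ B) = linear-signs q A B
  linear-signs q (outside ∷ A) (outside ∷ B) = trans (cong (_+ linear (signs q B) A) (*-zeroʳ q)) (linear-signs q A B)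
  linear-signs q (inside ∷ A) (inside ∷ B) = cong suc (linear-signs q A B)
  linear-signs q (inside ∷ A) (outside ∷ B) = trans (cong (q * 1 +_) (linear-signs q A B)) (regroup q ∣ A ∩ B ∣ ∣ A ∩ ∁ B ∣)
    where
    regroup : ∀ q a b → q * 1 + (a + q * b) ≡ a + q * (1 + b)
    regroup = solve-∀

  half : ∀ k → ∃ λ h → k ≡ h + h ⊎ k ≡ suc (h + h)
  half zero = 0 , inj₁ refl
  half (suc k) with half k
  ... | h , inj₁ eq = h , inj₂ (cong suc eq)
  ... | h , inj₂ eq = suc h , inj₁ (trans (cong suc eq) (cong suc (sym (+-suc h h))))

  m+m≢1+n+n : ∀ m n → m + m ≢ suc (n + n)
  m+m≢1+n+n m n eq = even≢odd m n (begin
    2 * m         ≡⟨ cong (m +_) (+-identityʳ m) ⟩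
    m + m         ≡⟨ eq ⟩
    suc (n + n)   ≡⟨ cong (λ x → suc (n + x)) (+-identityʳ n) ⟨
    suc (2 * n)   ∎)
    where open ≡-Reasoning

  double-injective : ∀ a b → a + a ≡ b + b → a ≡ b
  double-injective zero zero eq = refl
  double-injective (suc a) (suc b) eq =
    cong suc (double-injective a b (suc-injective (trans (sym (+-suc a a)) (trans (suc-injective eq) (+-suc b b)))))

  close⇒≡ : ∀ a b h → b + a ≡ h + h → a ≤ b → b ∸ a ≤ 1 → b ≡ a
  close⇒≡ a b h b+a≡ a≤b d≤1 with b ∸ a | m+[n∸m]≡n a≤b
  close⇒≡ a b h b+a≡ a≤b d≤1 | zero | e = trans (sym e) (+-identityʳ a)
  close⇒≡ a b h b+a≡ a≤b d≤1 | suc zero | e =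
    contradiction (trans (sym b+a≡) (cong (_+ a) (trans (sym e) (+-comm a 1)))) (m+m≢1+n+n h a)
  close⇒≡ a b h b+a≡ a≤b (s≤s ()) | suc (suc _) | e

  balanced : ∀ a b h → a + b ≡ h + h → ℤ.∣ ℤ.+ a ℤ.- ℤ.+ b ∣ ≤ 1 → a ≡ b
  balanced a b h a+b≡ close with ≤-total a b
  ... | inj₁ a≤b = sym (close⇒≡ a b h (trans (+-comm b a) a+b≡) a≤b
        (subst (_≤ 1) (trans (cong ℤ.∣_∣ (ℤ.[+m]-[+n]≡m⊖n a b)) (ℤ.∣⊖∣-≤ a≤b)) close))
  ... | inj₂ b≤a = close⇒≡ b a h a+b≡ b≤a
        (subst (_≤ 1) (trans (cong ℤ.∣_∣ (ℤ.[+m]-[+n]≡m⊖n a b)) (trans (ℤ.∣m⊖n∣≡∣n⊖m∣ a b) (ℤ.∣⊖∣-≤ b≤a))) close)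

  small-multiple : ∀ {p d} → d < p → p ∣ d → d ≡ 0
  small-multiple {d = zero}  d<p p∣d = refl
  small-multiple {d = suc d} d<p p∣d = contradiction p∣d (>⇒∤ d<p)

  -- Modulo `p = q + 1` the number is `a - b`, whose absolute value is at most `a + b < p`. The case
  -- split keeps the difference a natural number.
  p∣a+[p-1]b⇒a≡b : ∀ q a b → a + b < suc q → suc q ∣ a + q * b → a ≡ b
  p∣a+[p-1]b⇒a≡b q a b a+b<p p∣ with ≤-total a b
  ... | inj₁ a≤b = sym (trans (sym (m+[n∸m]≡n a≤b)) (trans (cong (a +_) d≡0) (+-identityʳ a)))
    where
    d = b ∸ a
    regroup : ∀ q a d → (a + q * (a + d)) + d ≡ (1 + q) * (a + d)
    regroup = solve-∀
    d≡0 : d ≡ 0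
    d≡0 = small-multiple (≤-<-trans (m∸n≤m b a) (≤-<-trans (m≤n+m b a) a+b<p))
      (∣m+n∣m⇒∣n (subst (suc q ∣_) (sym (regroup q a d)) (m∣m*n (a + d)))
        (subst (λ z → suc q ∣ a + q * z) (sym (m+[n∸m]≡n a≤b)) p∣))
  ... | inj₂ b≤a = trans (sym (m+[n∸m]≡n b≤a)) (trans (cong (b +_) d≡0) (+-identityʳ b))
    where
    d = a ∸ b
    regroup : ∀ q b d → (b + d) + q * b ≡ (1 + q) * b + d
    regroup = solve-∀
    d≡0 : d ≡ 0
    d≡0 = small-multiple (≤-<-trans (m∸n≤m a b) (≤-<-trans (m≤m+n a b) a+b<p))
      (∣m+n∣m⇒∣n (subst (suc q ∣_) (trans (cong (_+ q * b) (sym (m+[n∸m]≡n b≤a))) (regroup q b d)) p∣) (m∣m*n b))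

  odd-prime : ∀ {p} → Prime p → 2 < p → ∀ e → p ≢ e + e
  odd-prime {p} pp 2<p e p≡ with prime⇒irreducible pp (divides e (trans p≡ (trans (cong (e +_) (sym (+-identityʳ e))) (*-comm 2 e))))
  ... | inj₁ ()
  ... | inj₂ refl = <-irrefl refl 2<p

  -- If `t = 2u`, then `w` is even as well, say `2v`, and `h = up + v` falls under
  -- `p∤centralBinomial`; the bound `2h < p²` supplies `2u < p`.
  odd-quotient : ∀ {p} h t w → Prime p → p ∣ centralBinomial h → h + h < p * p → h + h ≡ t * p + w → w < p →
    ∃ λ u → t ≡ suc (u + u)
  odd-quotient {p} h t w pp p∣C h+h<p² eq w<p with half t
  ... | u , inj₂ t≡ = u , t≡
  ... | u , inj₁ refl with half w
  ...   | v , inj₂ refl = contradiction (trans eq (regroup u v p)) (m+m≢1+n+n h (u * p + v))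
    where
    regroup : ∀ u v p → (u + u) * p + suc (v + v) ≡ suc ((u * p + v) + (u * p + v))
    regroup = solve-∀
  ...   | v , inj₁ refl with double-injective h (u * p + v) (trans eq (regroup u v p))
    where
    regroup : ∀ u v p → (u + u) * p + (v + v) ≡ (u * p + v) + (u * p + v)
    regroup = solve-∀
  ...     | refl = contradiction p∣C (p∤centralBinomial u v pp
    (*-cancelʳ-< p (u + u) p (≤-<-trans (m≤m+n ((u + u) * p) (v + v)) (subst (_< p * p) eq h+h<p²))) w<p)

  -- The contradiction for one prime, and the hard family

  module _ {n h q : ℕ} (pp : Prime (suc q)) (2<p : 2 < suc q) (p∣C : suc q ∣ centralBinomial h)
           (h+h<p² : h + h < suc q * suc q) (F′ : Family n) (m<p : length F′ < suc q)
           (room : h + h + length F′ ≤ n) where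

    private
      p = suc q
      t = (h + h) / p
      w = (h + h) % p
      decomposition : h + h ≡ t * p + w
      decomposition = trans (m≡m%n+[m/n]*n (h + h) p) (+-comm w (t * p))

    not-secting : ¬ (∀ A → ∣ A ∣ ≡ h + h → Any (λ A′ → D±1 (sectVal A A′)) F′)
    not-secting sects with odd-quotient h t w pp p∣C h+h<p² decomposition (m%n<n (h + h) p)
    -- Any set of size `w` can serve as `y`; one is obtained by enlarging the empty set.
    ... | u , t≡ with superset-of-size {n} ∅ w (subst (_≤ w) (sym (∣⊥∣≡0 n)) z≤n)
                    (≤-trans (m≤n+m w (t * p)) (≤-trans (≤-reflexive (sym decomposition)) (≤-trans (m≤m+n (h + h) (length F′)) room)))
    ...   | y , _ , y≡w = unbalanced (Any.satisfied (Any.map⁻ hit))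
      where
      us = map (signs q) F′
      hits : ∀ A → ∣ A ∣ ≡ t * p + w → Any (λ v → p ∣ linear v A) us
      hits A size = Any.map⁺ (Any.map divisible (sects A size′))
        where
        size′ = trans size (sym decomposition)
        divisible : ∀ {A′} → D±1 (sectVal A A′) → p ∣ linear (signs q A′) A
        divisible {A′} close = subst (p ∣_) (sym (trans (linear-signs q A A′)
          (cong (λ z → z + q * ∣ A ∩ ∁ A′ ∣) (balanced ∣ A ∩ A′ ∣ ∣ A ∩ ∁ A′ ∣ h (trans (∣A∩B∣+∣A∩∁B∣ A A′) size′) close))))
          (m∣m*n ∣ A ∩ ∁ A′ ∣)
      m≡ : length us ≡ length F′
      m≡ = length-map (signs q) F′
      hit : Any (λ v → p ∣ linear v y) us
      hit = descend* w t pp us (subst (_< p) (sym m≡) m<p)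
        (subst (_≤ n) (cong₂ _+_ decomposition (sym m≡)) room) hits y y≡w
      unbalanced : (∃ λ A′ → p ∣ linear (signs q A′) y) → ⊥
      unbalanced (A′ , p∣) = odd-w (p∣a+[p-1]b⇒a≡b q a b (subst (_< p) (sym a+b≡w) (m%n<n (h + h) p))
                                     (subst (p ∣_) (linear-signs q y A′) p∣))
        where
        a = ∣ y ∩ A′ ∣
        b = ∣ y ∩ ∁ A′ ∣
        a+b≡w : a + b ≡ w
        a+b≡w = trans (∣A∩B∣+∣A∩∁B∣ y A′) y≡w
        regroup : ∀ u p b → suc (u + u) * p + (b + b) ≡ p + ((u * p + b) + (u * p + b))
        regroup = solve-∀
        odd-w : a ≡ b → ⊥
        odd-w a≡b with half p
        ... | e , inj₁ p≡ = odd-prime pp 2<p e p≡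
        -- With `a = b` the remainder `w` is even; as `t` and `p` are odd, `tp + w = 2h` would be
        -- odd.
        ... | e , inj₂ p≡ = m+m≢1+n+n h (e + (u * p + b)) (trans decomposition
          (trans (cong₂ (λ x z → x * p + z) t≡ (trans (sym a+b≡w) (cong (_+ b) a≡b)))
            (trans (regroup u p b) (trans (cong (_+ ((u * p + b) + (u * p + b))) p≡) (collect e (u * p + b))))))
          where
          collect : ∀ e x → suc (e + e) + (x + x) ≡ suc ((e + x) + (e + x))
          collect = solve-∀

  module _ {n k h : ℕ} (2048≤h : 2048 ≤ h) (h+h≤k : h + h ≤ k) (k≤1+h+h : k ≤ suc (h + h)) where

    -- If both alternatives fail, `not-secting` excludes every prime divisor of `C(2h, h)` above
    -- `4^g`, against `large-prime-divisor`.
    β-lower-bound : (F′ : Family n) → Secting D±1 (subsetsOf ⊤ (h + h)) F′ →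
      k ≤ 4096 * length F′ ⊎ n ≤ k + length F′
    β-lower-bound F′ secting with k ≤? 4096 * length F′ | n ≤? k + length F′
    ... | yes small | _ = inj₁ small
    ... | no _ | yes small = inj₂ small
    ... | no k≰4096m | no n≰k+m with scale-of (h ∸ 2048)
    ...   | i , lo , hi = contradiction small
      (large-prime-divisor i h (subst (2 * 4 ^ (5 + i) ≤_) h≡ lo) h<8x)
      where
      open ≤-Reasoning
      m = length F′
      x = 4 ^ (5 + i)
      h≡ : h ∸ 2048 + 2048 ≡ h
      h≡ = m∸n+n≡m 2048≤h
      h<8x : h < 8 * x
      h<8x = subst (_< 8 * x) h≡ hi
      sum16 : ∀ x → 8 * x + 8 * x ≡ 16 * x
      sum16 = solve-∀
      h+h<16x : h + h < 16 * x
      h+h<16x = <-≤-trans (+-mono-< h<8x h<8x) (≤-reflexive (sum16 x))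
      16≤x : 16 ≤ x
      16≤x = ^-monoʳ-≤ 4 {2} {5 + i} (s≤s (s≤s z≤n))
      small : ∀ p → Prime p → p ∣ centralBinomial h → p ≤ x
      small zero pp p∣C = z≤n
      small p@(suc _) pp p∣C with p ≤? x
      ... | yes p≤x = p≤x
      ... | no p≰x = contradiction (subsetsOf⊤-complete _ (h + h) secting)
          (not-secting {h = h} pp 2<p p∣C h+h<p² F′ m<p room)
        where
        x<p : x < p
        x<p = ≰⇒> p≰x
        2<p : 2 < p
        2<p = ≤-<-trans (≤-trans (s≤s (s≤s z≤n)) 16≤x) x<p
        h+h<p² : h + h < p * p
        h+h<p² = begin-strict
          h + h   <⟨ h+h<16x ⟩
          16 * x  ≤⟨ *-monoˡ-≤ x 16≤x ⟩
          x * x   ≤⟨ *-mono-≤ (<⇒≤ x<p) (<⇒≤ x<p) ⟩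
          p * p   ∎
        m<p : m < p
        m<p = *-cancelˡ-< 4096 m p (begin-strict
          4096 * m     <⟨ ≰⇒> k≰4096m ⟩
          k            ≤⟨ k≤1+h+h ⟩
          suc (h + h)  ≤⟨ h+h<16x ⟩
          -- A factor 16 would do here; 4096 is dictated by the small `k` in `hard-family`.
          16 * x       ≤⟨ *-mono-≤ (m≤m+n 16 4080) (<⇒≤ x<p) ⟩
          4096 * p     ∎)
        room : h + h + m ≤ n
        room = ≤-trans (+-monoˡ-≤ m h+h≤k) (<⇒≤ (≰⇒> n≰k+m))

  Uniform-subsetsOf⊤ : ∀ {n} k → Uniform (ℤ.+ k) (subsetsOf (⊤ {n}) k)
  Uniform-subsetsOf⊤ k = All.map (λ (size , _) → cong ℤ.+_ size) (subsetsOf-sound ⊤ k)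

  Uniform-cong : ∀ {n ℓ ℓ′} {F : Family n} → ℓ ≡ ℓ′ → Uniform ℓ F → Uniform ℓ′ F
  Uniform-cong refl u = u

  k≤b+b : ∀ {k h b} → k ≡ h + h ⊎ k ≡ suc (h + h) → ¬ b ≤ h → k ≤ b + b
  k≤b+b {k} {h} {b} k≡ b≰h = ≤-trans ([ (λ e → ≤-trans (≤-reflexive e) (n≤1+n _)) , ≤-reflexive ]′ k≡)
    (+-mono-<-≤ (≰⇒> b≰h) (≰⇒≥ b≰h))

  -- For `h ≥ 2048` the family consists of all `2h`-sets and `j` is the parity of `k`. Below that, a
  -- single `k`-set forces `F′` to be nonempty, which is enough as `k ≤ 4096`.
  hard-family : ∀ n k → k ≤ n → Σ (Fin 4) λ j → Σ (Family n) λ F → Uniform (ℤ.+ k ℤ.- ℤ.+ toℕ j) F ×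
    ((F′ : Family n) → Secting D±1 F F′ → k ≤ 4096 * length F′ ⊎ n ≤ k + length F′)
  hard-family n k k≤n with half k
  ... | h , k≡ with 2048 ≤? h
  ... | no 2048≰h with superset-of-size ∅ k (subst (_≤ k) (sym (∣⊥∣≡0 n)) z≤n) k≤n
  ...   | A , _ , ∣A∣≡k = Fin.zero , A ∷ [] , (trans (cong ℤ.+_ ∣A∣≡k) (sym (ℤ.+-identityʳ (ℤ.+ k))) ∷ []) , bound
    where
    k≤4096 : k ≤ 4096
    k≤4096 = k≤b+b {b = 2048} k≡ 2048≰h
    bound : ∀ F′ → Secting D±1 (A ∷ []) F′ → k ≤ 4096 * length F′ ⊎ n ≤ k + length F′
    bound [] (() ∷ _)
    bound (A′ ∷ F′) _ = inj₁ (≤-trans k≤4096 (m≤m*n 4096 (length (A′ ∷ F′))))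
  hard-family n k k≤n | h , inj₁ k≡ | yes 2048≤h =
    Fin.zero , subsetsOf ⊤ (h + h) ,
    Uniform-cong (trans (cong ℤ.+_ (sym k≡)) (sym (ℤ.+-identityʳ (ℤ.+ k)))) (Uniform-subsetsOf⊤ (h + h)) ,
    β-lower-bound 2048≤h (≤-reflexive (sym k≡)) (m≤n⇒m≤1+n (≤-reflexive k≡))
  hard-family n k k≤n | h , inj₂ refl | yes 2048≤h =
    Fin.suc Fin.zero , subsetsOf ⊤ (h + h) , Uniform-subsetsOf⊤ (h + h) ,
    β-lower-bound 2048≤h (n≤1+n _) ≤-refl

open Combinatorial using (hard-family)

open import Data.Nat using (ℕ)
open import Data.Integer using (ℤ; +_; _-_)
open import Data.Rational using (ℚ; 0ℚ; 1ℚ; ½; _<_; _*_; _/_)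
open import Data.Rational as Q using ()
open import Data.Fin using (Fin; toℕ)
open import Data.Product using (Σ; _×_)

open import Data.Nat as ℕ using (suc)
import Data.Nat.Properties as ℕ
import Data.Integer as ℤ
import Data.Integer.Properties as ℤ
open import Data.Rational using (_≤_; Positive; NonNegative; toℚᵘ; positive; nonNegative)
import Data.Rational.Properties as ℚ
import Data.Rational.Unnormalised.Base as ℚᵘ
import Data.Rational.Unnormalised.Properties as ℚᵘ
open import Data.Rational.Solver using (module +-*-Solver)
open import Data.Product using (_,_)
open import Data.List.Base using (length)
open import Data.Sum using (_⊎_; inj₁; inj₂)
open import Relation.Nullary using (yes; no; contradiction)
open import Relation.Binary.PropositionalEquality using (_≡_; refl; sym; trans; cong; cong₂; subst)

-- Passage from the integer dichotomy to a rational density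

/1-mono-≤ : ∀ {i j} → i ℤ.≤ j → i / 1 ≤ j / 1
/1-mono-≤ {i} {j} i≤j = ℚ.toℚᵘ-cancel-≤ (begin
  toℚᵘ (i / 1)    ≃⟨ ℚ.toℚᵘ-fromℚᵘ (ℚᵘ.mkℚᵘ i 0) ⟩
  ℚᵘ.mkℚᵘ i 0     ≤⟨ ℚᵘ.*≤* (ℤ.*-monoʳ-≤-nonNeg (+ 1) i≤j) ⟩
  ℚᵘ.mkℚᵘ j 0     ≃⟨ ℚ.toℚᵘ-fromℚᵘ (ℚᵘ.mkℚᵘ j 0) ⟨
  toℚᵘ (j / 1)    ∎)
  where open ℚᵘ.≤-Reasoning

toℚ-mono-≤ : ∀ {a b} → a ℕ.≤ b → toℚ a ≤ toℚ b
toℚ-mono-≤ a≤b = /1-mono-≤ (ℤ.+≤+ a≤b)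

toℚ-+ : ∀ a b → toℚ (a ℕ.+ b) ≡ toℚ a Q.+ toℚ b
toℚ-+ a b = ℚ.toℚᵘ-injective (begin-equality
  toℚᵘ (toℚ (a ℕ.+ b))                      ≃⟨ ℚ.toℚᵘ-fromℚᵘ (ℚᵘ.mkℚᵘ (+ (a ℕ.+ b)) 0) ⟩
  ℚᵘ.mkℚᵘ (+ (a ℕ.+ b)) 0                   ≃⟨ ℚᵘ.*≡* (cong (ℤ._* + 1) (sym (cong₂ ℤ._+_ (ℤ.*-identityʳ (+ a)) (ℤ.*-identityʳ (+ b))))) ⟩
  ℚᵘ.mkℚᵘ (+ a) 0 ℚᵘ.+ ℚᵘ.mkℚᵘ (+ b) 0      ≃⟨ ℚᵘ.+-cong (ℚ.toℚᵘ-fromℚᵘ (ℚᵘ.mkℚᵘ (+ a) 0)) (ℚ.toℚᵘ-fromℚᵘ (ℚᵘ.mkℚᵘ (+ b) 0)) ⟨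
  toℚᵘ (toℚ a) ℚᵘ.+ toℚᵘ (toℚ b)            ≃⟨ ℚ.toℚᵘ-homo-+ (toℚ a) (toℚ b) ⟨
  toℚᵘ (toℚ a Q.+ toℚ b)                    ∎)
  where open ℚᵘ.≤-Reasoning

toℚ-* : ∀ a b → toℚ (a ℕ.* b) ≡ toℚ a * toℚ b
toℚ-* a b = ℚ.toℚᵘ-injective (begin-equality
  toℚᵘ (toℚ (a ℕ.* b))                      ≃⟨ ℚ.toℚᵘ-fromℚᵘ (ℚᵘ.mkℚᵘ (+ (a ℕ.* b)) 0) ⟩
  ℚᵘ.mkℚᵘ (+ (a ℕ.* b)) 0                   ≃⟨ ℚᵘ.*≡* (cong (ℤ._* + 1) (ℤ.pos-* a b)) ⟩
  ℚᵘ.mkℚᵘ (+ a) 0 ℚᵘ.* ℚᵘ.mkℚᵘ (+ b) 0      ≃⟨ ℚᵘ.*-cong (ℚ.toℚᵘ-fromℚᵘ (ℚᵘ.mkℚᵘ (+ a) 0)) (ℚ.toℚᵘ-fromℚᵘ (ℚᵘ.mkℚᵘ (+ b) 0)) ⟨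
  toℚᵘ (toℚ a) ℚᵘ.* toℚᵘ (toℚ b)            ≃⟨ ℚ.toℚᵘ-homo-* (toℚ a) (toℚ b) ⟨
  toℚᵘ (toℚ a * toℚ b)                      ∎)
  where open ℚᵘ.≤-Reasoning

module Density (d : ℕ) (c : ℚ) (0<c : 0ℚ < c) where

  open +-*-Solver

  ε : ℚ
  ε = + 1 / suc d

  δ : ℚ
  δ = c * ε

  instance
    c-pos : Positive c
    c-pos = positive 0<c
    c-nonNeg : NonNegative c
    c-nonNeg = ℚ.pos⇒nonNeg c
    ε-pos : Positive ε
    ε-pos = ℚ.normalize-pos 1 (suc d)
    ε-nonNeg : NonNegative ε
    ε-nonNeg = ℚ.pos⇒nonNeg ε

  ε≤1 : ε ≤ 1ℚ
  ε≤1 = ℚ.toℚᵘ-cancel-≤ (begin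
    toℚᵘ ε              ≃⟨ ℚ.toℚᵘ-fromℚᵘ (ℚᵘ.mkℚᵘ (+ 1) d) ⟩
    ℚᵘ.mkℚᵘ (+ 1) d     ≤⟨ ℚᵘ.*≤* (ℤ.+≤+ (ℕ.s≤s ℕ.z≤n)) ⟩
    ℚᵘ.1ℚᵘ              ∎)
    where open ℚᵘ.≤-Reasoning

  [1+d]*ε≡1 : toℚ (suc d) * ε ≡ 1ℚ
  [1+d]*ε≡1 = ℚ.toℚᵘ-injective (begin-equality
    toℚᵘ (toℚ (suc d) * ε)                       ≃⟨ ℚ.toℚᵘ-homo-* (toℚ (suc d)) ε ⟩
    toℚᵘ (toℚ (suc d)) ℚᵘ.* toℚᵘ ε               ≃⟨ ℚᵘ.*-cong (ℚ.toℚᵘ-fromℚᵘ (ℚᵘ.mkℚᵘ (+ suc d) 0)) (ℚ.toℚᵘ-fromℚᵘ (ℚᵘ.mkℚᵘ (+ 1) d)) ⟩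
    ℚᵘ.mkℚᵘ (+ suc d) 0 ℚᵘ.* ℚᵘ.mkℚᵘ (+ 1) d     ≃⟨ ℚᵘ.*-inverseʳ (ℚᵘ.mkℚᵘ (+ suc d) 0) ⟩
    ℚᵘ.1ℚᵘ                                       ∎)
    where open ℚᵘ.≤-Reasoning

  0<δ : 0ℚ < δ
  0<δ = subst (_< δ) (ℚ.*-zeroˡ ε) (ℚ.*-monoˡ-<-pos ε 0<c)

  toℚ-nonNeg : ∀ n → NonNegative (toℚ n)
  toℚ-nonNeg n = ℚ.normalize-nonNeg n 1

  0≤c*n : ∀ n → 0ℚ ≤ c * toℚ n
  0≤c*n n = ℚ.nonNegative⁻¹ (c * toℚ n) {{ℚ.nonNeg*nonNeg⇒nonNeg c (toℚ n) {{toℚ-nonNeg n}}}}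

  δ*n≡ : ∀ n → δ * toℚ n ≡ c * toℚ n * ε
  δ*n≡ n = solve 3 (λ c e x → c :* e :* x := c :* x :* e) refl c ε (toℚ n)

  [1-c]*n+c*n≡n : ∀ n → (1ℚ Q.- c) * toℚ n Q.+ c * toℚ n ≡ toℚ n
  [1-c]*n+c*n≡n n = solve 2 (λ c x → (con 1ℚ :+ :- c) :* x :+ c :* x := x) refl c (toℚ n)

  c*n+k<n : ∀ {n k} → k / 1 < (1ℚ Q.- c) * toℚ n → k / 1 Q.+ c * toℚ n < toℚ n
  c*n+k<n {n} {k} k< = subst (k / 1 Q.+ c * toℚ n <_) ([1-c]*n+c*n≡n n) (ℚ.+-monoˡ-< (c * toℚ n) k<)

  k≤n : ∀ {n k} → (+ k) / 1 < (1ℚ Q.- c) * toℚ n → k ℕ.≤ n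
  k≤n {n} {k} k< with k ℕ.≤? n
  ... | yes k≤ = k≤
  ... | no k≰ = contradiction (begin-strict
    toℚ k                  ≡⟨ ℚ.+-identityʳ (toℚ k) ⟨
    toℚ k Q.+ 0ℚ           ≤⟨ ℚ.+-monoʳ-≤ (toℚ k) (0≤c*n n) ⟩
    toℚ k Q.+ c * toℚ n    <⟨ c*n+k<n {n} {+ k} k< ⟩
    toℚ n                  ≤⟨ toℚ-mono-≤ {n} {k} (ℕ.≰⇒≥ k≰) ⟩
    toℚ k                  ∎) (ℚ.<-irrefl refl)
    where open ℚ.≤-Reasoning

  -- The first alternative is scaled by `ε = 1/(d+1)` and uses `cn < k`. The second uses
  -- `k < (1 - c)n`, which gives `cn < n - k ≤ m`, and `ε ≤ 1`.
  δ*n≤m : ∀ {n k m} → c * toℚ n < (+ k) / 1 → (+ k) / 1 < (1ℚ Q.- c) * toℚ n →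
    k ℕ.≤ suc d ℕ.* m ⊎ n ℕ.≤ k ℕ.+ m → δ * toℚ n ≤ toℚ m
  δ*n≤m {n} {k} {m} cn<k _ (inj₁ k≤[1+d]m) = begin
    δ * toℚ n                   ≡⟨ δ*n≡ n ⟩
    c * toℚ n * ε               ≤⟨ ℚ.*-monoʳ-≤-nonNeg ε (ℚ.<⇒≤ cn<k) ⟩
    toℚ k * ε                   ≤⟨ ℚ.*-monoʳ-≤-nonNeg ε (toℚ-mono-≤ {k} {suc d ℕ.* m} k≤[1+d]m) ⟩
    toℚ (suc d ℕ.* m) * ε       ≡⟨ cong (_* ε) (trans (toℚ-* (suc d) m) (ℚ.*-comm (toℚ (suc d)) (toℚ m))) ⟩
    toℚ m * toℚ (suc d) * ε     ≡⟨ ℚ.*-assoc (toℚ m) (toℚ (suc d)) ε ⟩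
    toℚ m * (toℚ (suc d) * ε)   ≡⟨ cong (toℚ m *_) [1+d]*ε≡1 ⟩
    toℚ m * 1ℚ                  ≡⟨ ℚ.*-identityʳ (toℚ m) ⟩
    toℚ m                       ∎
    where open ℚ.≤-Reasoning
  δ*n≤m {n} {k} {m} _ k< (inj₂ n≤k+m) = begin
    δ * toℚ n                   ≡⟨ δ*n≡ n ⟩
    c * toℚ n * ε               ≤⟨ ℚ.*-monoˡ-≤-nonNeg (c * toℚ n) {{nonNegative (0≤c*n n)}} ε≤1 ⟩
    c * toℚ n * 1ℚ              ≡⟨ ℚ.*-identityʳ (c * toℚ n) ⟩
    c * toℚ n                   ≡⟨ solve 2 (λ x y → x := :- y :+ (y :+ x)) refl (c * toℚ n) (toℚ k) ⟩
    Q.- toℚ k Q.+ (toℚ k Q.+ c * toℚ n) ≤⟨ ℚ.+-monoʳ-≤ (Q.- toℚ k) (ℚ.≤-trans (ℚ.<⇒≤ (c*n+k<n {n} {+ k} k<)) (toℚ-mono-≤ {n} {k ℕ.+ m} n≤k+m)) ⟩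
    Q.- toℚ k Q.+ toℚ (k ℕ.+ m) ≡⟨ cong (Q.- toℚ k Q.+_) (toℚ-+ k m) ⟩
    Q.- toℚ k Q.+ (toℚ k Q.+ toℚ m) ≡⟨ solve 2 (λ x y → :- y :+ (y :+ x) := x) refl (toℚ m) (toℚ k) ⟩
    toℚ m                       ∎
    where open ℚ.≤-Reasoning

  linear-bound : (∀ n k → k ℕ.≤ n → Σ (Fin 4) λ j → Σ (Family n) λ F → Uniform (+ k - + toℕ j) F ×
      ((F′ : Family n) → Secting D±1 F F′ → k ℕ.≤ suc d ℕ.* length F′ ⊎ n ℕ.≤ k ℕ.+ length F′)) →
    (n : ℕ) (k : ℤ) → c * toℚ n < k / 1 → k / 1 < (1ℚ Q.- c) * toℚ n →
    Σ (Fin 4) (λ j → βnkAtLeast n (k - + toℕ j) (δ * toℚ n))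
  linear-bound family n ℤ.-[1+ a ] cn<k _ =
    -- A negative `k` cannot exceed `cn ≥ 0`.
    contradiction (ℚ.≤-<-trans (0≤c*n n) (ℚ.<-≤-trans cn<k (/1-mono-≤ {ℤ.-[1+ a ]} {+ 0} ℤ.-≤+))) (ℚ.<-irrefl refl)
  linear-bound family n (+ k) cn<k k< with family n k (k≤n {n} {k} k<)
  ... | j , F , uniform , hard = j , F , uniform , λ F′ secting → δ*n≤m {n} {k} {length F′} cn<k k< (hard F′ secting)

theorem5 : (c : ℚ) → 0ℚ < c → c < ½ →
    Σ ℚ (λ δ → 0ℚ < δ × ((n : ℕ) (k : ℤ) → c * toℚ n < k / 1 → k / 1 < (1ℚ Q.- c) * toℚ n →
    Σ (Fin 4) (λ j → βnkAtLeast n (k - + toℕ j) (δ * toℚ n))))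
theorem5 c 0<c _ = δ , 0<δ , linear-bound hard-family
  -- `suc 4095` is the constant 4096 of `hard-family`, so `δ = c/4096`.
  where open Density 4095 c 0<c
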